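{- There exists an infinite set $\mathcal S$ of prime numbers, all congruent to $2\pmod 3$, such that for every $p\in\mathcal S$: (1) for every $n\in\mathbb Z$ with $n\equiv 1/3\pmod{p-1}$ we have $\nu_p(T(n))\ge \nu_p(n-1/3)$; (2) for every $n\in\mathbb Z$ with $n\equiv -5/3\pmod{p-1}$ we have $\nu_p(T(n))\ge \nu_p(n+5/3)$.
   Context: $T:\mathbb Z\to\mathbb Z$ is the Tribonacci sequence: $T(0)=0$, $T(1)=T(2)=1$, $T(n+3)=T(n+2)+T(n+1)+T(n)$ for all $n\in\mathbb Z$. For a prime $p$, $\nu_p$ is the $p$-adic valuation on $\mathbb Q$, with $\nu_p(0)=+\infty$. Convention for congruences of rationals: for $x,y\in\mathbb Q$ and a positive integer $M$, $x\equiv y\pmod M$ means there exists $m\in\mathbb Z$ with $\gcd(m,M)=1$, $mx,my\in\mathbb Z$ and $mx\equiv my\pmod M$ (for $p\equiv 2\pmod 3$ one has $3\nmid p-1$, so the classes $1/3$ and $-5/3$ modulo $p-1$ make sense). -}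

module Defs where

open import Data.Integer as ℤ using (ℤ; +_; -[1+_])
import Data.Integer.Divisibility as ℤ using (_∣_)
open import Data.Integer.GCD using (gcd)
open import Data.Integer.Tactic.RingSolver using (solve-∀)
open import Data.Nat as ℕ using (ℕ; zero; suc; z≤n; s≤s)
open import Data.Nat.Divisibility as ℕ using (_∣?_)
import Data.Nat.Properties as ℕ
open import Data.Product using (∃-syntax; _×_)
open import Data.Rational as ℚ using (ℚ; _/_)
open import Data.Sum using (inj₁; inj₂)
open import Level using (Level)
open import Relation.Binary.PropositionalEquality using (_≡_; _≢_; refl)
import Relation.Binary.Construct.Add.Supremum.NonStrict ℤ._≤_ as Sup
open import Relation.Nullary using (yes; no; contradiction)
open import Relation.Nullary.Construct.Add.Supremum using (_⁺; ⊤⁺; [_])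
open import Relation.Unary using (Pred; _∈_)

private variable ℓ : Level

Infinite : Pred ℕ ℓ → Set ℓ
Infinite S = ∀ N → ∃[ n ] N ℕ.< n × n ∈ S

-- T⁺ k is T(k) and T⁻ k is T(-k), the latter obtained by running the
-- recurrence backwards: T(-(k+3)) = T(-k) - T(-(k+1)) - T(-(k+2)).
T⁺ : ℕ → ℤ
T⁺ 0 = + 0
T⁺ 1 = + 1
T⁺ 2 = + 1
T⁺ (suc (suc (suc k))) = T⁺ (suc (suc k)) ℤ.+ T⁺ (suc k) ℤ.+ T⁺ k

T⁻ : ℕ → ℤ
T⁻ 0 = + 0
T⁻ 1 = + 0
T⁻ 2 = + 1
T⁻ (suc (suc (suc k))) = T⁻ k ℤ.- T⁻ (suc k) ℤ.- T⁻ (suc (suc k))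

T : ℤ → ℤ
T (+ k)    = T⁺ k
T -[1+ k ] = T⁻ (suc k)

T-recurrence : ∀ n → T (n ℤ.+ + 3) ≡ T (n ℤ.+ + 2) ℤ.+ T (n ℤ.+ + 1) ℤ.+ T n
T-recurrence (+ k) rewrite ℕ.+-comm k 3 | ℕ.+-comm k 2 | ℕ.+-comm k 1 = refl
T-recurrence -[1+ 0 ] = refl
T-recurrence -[1+ 1 ] = refl
T-recurrence -[1+ 2 ] = refl
T-recurrence -[1+ suc (suc (suc k)) ] =
  backwards (T⁻ (suc k)) (T⁻ (suc (suc k))) (T⁻ (suc (suc (suc k))))
  where
  backwards : ∀ a b c → a ≡ b ℤ.+ c ℤ.+ (a ℤ.- b ℤ.- c)
  backwards = solve-∀

-- The largest k ≤ b such that p ^ k divides n.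
maxExponent : (p n b : ℕ) → ℕ
maxExponent p n zero    = 0
maxExponent p n (suc b) with p ℕ.^ suc b ∣? n
... | yes _ = suc b
... | no  _ = maxExponent p n b

-- For p ≥ 2 and n ≥ 1, p ^ k ∣ n forces k < n, so n is a sufficient bound.
-- The value is meaningless when p ≤ 1 or n = 0.
νℕ : (p n : ℕ) → ℕ
νℕ p n = maxExponent p n n

module _ (p n : ℕ) where

  maxExponent-divides : ∀ b → p ℕ.^ maxExponent p n b ℕ.∣ n
  maxExponent-divides zero = ℕ.1∣ n
  maxExponent-divides (suc b) with p ℕ.^ suc b ∣? n
  ... | yes d = d
  ... | no  _ = maxExponent-divides b

  maxExponent-greatest : ∀ b {k} → k ℕ.≤ b → p ℕ.^ k ℕ.∣ n → k ℕ.≤ maxExponent p n b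
  maxExponent-greatest zero k≤b _ = k≤b
  maxExponent-greatest (suc b) k≤b d with p ℕ.^ suc b ∣? n
  ... | yes _ = k≤b
  ... | no ¬d with ℕ.m≤n⇒m<n∨m≡n k≤b
  ...   | inj₁ (s≤s k≤b′) = maxExponent-greatest b k≤b′ d
  ...   | inj₂ refl       = contradiction d ¬d

  νℕ-divides : p ℕ.^ νℕ p n ℕ.∣ n
  νℕ-divides = maxExponent-divides n

  νℕ-greatest : 1 ℕ.< p → n ≢ 0 → ∀ {k} → p ℕ.^ k ℕ.∣ n → k ℕ.≤ νℕ p n
  νℕ-greatest 1<p n≢0 {k} d = maxExponent-greatest n k≤n d
    where
    k<p^k : ∀ k → k ℕ.< p ℕ.^ k
    k<p^k zero    = s≤s z≤n
    k<p^k (suc k) = begin-strict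
      suc k             ≤⟨ k<p^k k ⟩
      p ℕ.^ k           <⟨ ℕ.^-monoʳ-< p 1<p (ℕ.n<1+n k) ⟩
      p ℕ.^ suc k       ∎
      where open ℕ.≤-Reasoning
    k≤n : k ℕ.≤ n
    k≤n = ℕ.≤-trans (ℕ.<⇒≤ (k<p^k k)) (ℕ.∣⇒≤ ⦃ ℕ.≢-nonZero n≢0 ⦄ d)

-- The p-adic valuation on ℚ, meaningful for p prime; ⊤⁺ is +∞.
ν : ℕ → ℚ → ℤ ⁺
ν p x with ℚ.numerator x
... | + 0 = ⊤⁺
... | a   = [ + νℕ p ℤ.∣ a ∣ ℤ.- + νℕ p (ℚ.denominatorℕ x) ]

infix 4 _≥⁺_
_≥⁺_ : ℤ ⁺ → ℤ ⁺ → Set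
u ≥⁺ v = v Sup.≤⁺ u

fromℤ : ℤ → ℚ
fromℤ n = n / 1

infix 4 _≡_[mod_]
_≡_[mod_] : ℚ → ℚ → ℕ → Set
x ≡ y [mod M ] =
  ∃[ m ] gcd m (+ M) ≡ + 1 ×
  (∃[ a ] ∃[ b ] fromℤ m ℚ.* x ≡ fromℤ a × fromℤ m ℚ.* y ≡ fromℤ b × + M ℤ.∣ a ℤ.- b)

-- Let χ = X³ − X² − X − 1 and let θ be a root, so that T(n) is a coefficient of θⁿ⁺¹ in ℤ[θ]. If χ splits
-- into distinct linear factors modulo p, then θᵖ⁻¹ ≡ 1 modulo p, hence θ^((p−1)pᵏ) ≡ 1 modulo pᵏ⁺¹. For n with
-- 3n ≡ 1 modulo (p−1)pᵏ the power x = θⁿ is therefore a cube root of θ modulo pᵏ⁺¹, of norm 1. Newton's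
-- identities for its trace u and its second symmetric function v read u³ − 3uv + 2 ≡ 0 and
-- v³ − 3uv + 4 ≡ 0, whence (w − 2)(w² − 7w + 4) ≡ 0 for w = uv. The quadratic factor has discriminant 33 and
-- that of χ is −44, so for p ≡ 2 mod 3 (where −3 is not a square) it has no root modulo p. So
-- uv ≡ 2 and v³ ≡ 2, i.e. u ≡ v², and the Cayley–Hamilton relation x³ = ux² − vx + 1, with x³ ≡ θ, gives
-- u T(n) ≡ (u − v²) T(n−1) ≡ 0 and similarly u T(n−2) ≡ 0.
--
-- The polynomial h = (X(X² − 4))² + 44 of the differences of the roots of χ has the property that χ splits
-- modulo every prime p ≡ 2 mod 3, p ≠ 2, 11, dividing a value of h. As h(2y) = 4(16(y(y² − 1))² + 11), where the
-- second factor is odd and is 2 modulo 3 if 3 ∣ y, choosing y divisible by all small primes other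
-- than 11 but with 11 ∤ y(y² − 1) produces arbitrarily large such primes.

module Submission where

open import Defs
open import Algebra.Bundles using (CommutativeRing)
open import Algebra.Consequences.Propositional using (comm∧idˡ⇒id; comm∧distrˡ⇒distr)
import Algebra.Properties.CommutativeSemiring.Binomial as Binomial
import Algebra.Properties.CommutativeSemiring.Exp as Exp
import Algebra.Properties.Monoid.Mult as Mult
import Algebra.Properties.Monoid.Sum as MonoidSum
open import Data.Fin using (Fin; toℕ; fromℕ; inject₁) renaming (zero to fzero; suc to fsuc)
open import Data.Fin.Properties using (toℕ<n; toℕ-fromℕ; toℕ-inject₁)
open import Data.Integer using (ℤ; +_)
import Data.Integer as ℤ
import Data.Integer.Coprimality as ℤ
open import Data.Integer.Divisibility.Signed
open import Data.Integer.Properties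
import Data.Integer.Tactic.RingSolver as ℤ
open import Data.Integer.Tactic.RingSolver using (solve-∀)
open import Data.List using ([]; _∷_)
open import Data.List.Relation.Unary.All using (All; []; _∷_)
open import Data.Maybe using (just; nothing)
open import Data.Nat using (ℕ; _∸_; _%_; zero; suc; _!)
import Data.Nat as ℕ
open import Data.Nat.Combinatorics using (_C_; k![n∸k]!∣n!; nCk≡n!/k![n-k]!; nCn≡1)
open import Data.Nat.Coprimality as ℕ using (Coprime; coprime-divisor; 1-coprimeTo)
import Data.Nat.Divisibility as ℕ
open import Data.Nat.DivMod using (m≡m%n+[m/n]*n; m/n*n≡m; %-distribˡ-*; m%n<n; [m+kn]%n≡m%n)
open import Data.Nat.ListAction using (product)
open import Data.Nat.Primality
  using (Prime; euclidsLemma; prime?; prime⇒irreducible; prime⇒nonTrivial; prime⇒nonZero)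
open import Data.Nat.Primality.Factorisation using (PrimeFactorisation; factorise)
import Data.Nat.Properties as ℕ
open import Data.Product using (Σ-syntax; ∃-syntax; _×_; _,_; proj₁; proj₂)
open import Data.Rational as ℚ using (ℚ; mkℚ; toℚᵘ; ↥_; ↧_)
import Data.Rational.Properties as ℚ
open import Data.Rational.Unnormalised as ℚᵘ using (mkℚᵘ; *≡*)
import Data.Rational.Unnormalised.Properties as ℚᵘ
open import Data.Sum as Sum using (_⊎_; inj₁; inj₂)
open import Function using (_∘_; case_of_)
open import Level using (0ℓ)
import Relation.Binary.Construct.Add.Supremum.NonStrict ℤ._≤_ as Sup
open import Relation.Binary.PropositionalEquality
  using (_≡_; _≢_; refl; sym; trans; cong; cong₂; subst; subst₂; isEquivalence; module ≡-Reasoning)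
open import Relation.Nullary using (¬_; contradiction; yes; no)
open import Relation.Nullary.Decidable using (toWitness; toWitnessFalse)
open import Relation.Unary using (Pred; _∈_)
open import Tactic.RingSolver.Core.AlmostCommutativeRing using (AlmostCommutativeRing; fromCommutativeRing)
open import Tactic.RingSolver.Core.Expression using (Expr; Κ; _⊕_; _⊗_; ⊝_)
import Tactic.RingSolver.NonReflective as NonReflective

module _ where

  open Data.Integer using (-[1+_]; _+_; _*_; _-_; -_) renaming (∣_∣ to abs)
  open Exp +-*-commutativeSemiring using (_^_; ^-homo-*; ^-assocʳ)
  open Mult +-0-monoid using () renaming (_×_ to _·_)
  open MonoidSum +-0-monoid using (sum; sum-init-last)
  open NonReflective ℤ.ring using (_⊜_) renaming (solve to solveℤ)
  open ≡-Reasoning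

  -- Powers of θ have to be controlled for negative exponents too. Where the step law is invertible,
  -- one identity serves both directions.
  ℤ-ind : ∀ {ℓ} (P : ℤ → Set ℓ) → P (+ 0) →
          (∀ n → P n → P (+ 1 + n)) → (∀ n → P (+ 1 + n) → P n) → ∀ n → P n
  ℤ-ind P z up down (+ zero)     = z
  ℤ-ind P z up down (+ suc n)    = up (+ n) (ℤ-ind P z up down (+ n))
  ℤ-ind P z up down -[1+ zero ]  = down -[1+ 0 ] z
  ℤ-ind P z up down -[1+ suc n ] = down -[1+ suc n ] (ℤ-ind P z up down -[1+ n ])

  -- Divisibility by prime powers and Fermat's little theorem

  ∣-combine : ∀ {m a b c} s t → m ∣ a → m ∣ b → c ≡ s * a + t * b → m ∣ c
  ∣-combine s t m∣a m∣b refl = ∣m∣n⇒∣m+n (∣n⇒∣m*n s m∣a) (∣n⇒∣m*n t m∣b)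

  ∣-multiple : ∀ {m a c} s → m ∣ a → c ≡ s * a → m ∣ c
  ∣-multiple s m∣a refl = ∣n⇒∣m*n s m∣a

  module _ {p : ℕ} (pr : Prime p) where

    euclid : ∀ a b → + p ∣ a * b → + p ∣ a ⊎ + p ∣ b
    euclid a b d = Sum.map ∣ᵤ⇒∣ ∣ᵤ⇒∣
      (euclidsLemma (abs a) (abs b) pr (subst (p ℕ.∣_) (abs-* a b) (∣⇒∣ᵤ d)))

    cancel : ∀ {a b} → ¬ + p ∣ a → + p ∣ a * b → + p ∣ b
    cancel {a} {b} p∤a d with euclid a b d
    ... | inj₁ p∣a = contradiction p∣a p∤a
    ... | inj₂ p∣b = p∣b

    ∤-* : ∀ {a b} → ¬ + p ∣ a → ¬ + p ∣ b → ¬ + p ∣ a * b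
    ∤-* p∤a p∤b = p∤b ∘ cancel p∤a

    -- Induction on k: the smaller exponent gives b = c pᵏ, and cancelling pᵏ from the product
    -- leaves p ∣ a c, where Euclid's lemma applies.
    cancel-^ : ∀ k {a b} → ¬ + p ∣ a → + (p ℕ.^ k) ∣ a * b → + (p ℕ.^ k) ∣ b
    cancel-^ zero    {b = b} p∤a d = divides b (sym (*-identityʳ b))
    cancel-^ (suc k) {a} {b} p∤a (divides q eq) with cancel-^ k {a} {b} p∤a (divides (q * + p) (trans eq rearrange))
      where
      rearrange : q * + (p ℕ.* p ℕ.^ k) ≡ q * + p * + (p ℕ.^ k)
      rearrange = trans (cong (q *_) (pos-* p (p ℕ.^ k))) (sym (*-assoc q (+ p) (+ (p ℕ.^ k))))
    ... | divides c refl = subst₂ _∣_ (sym (pos-* p (p ℕ.^ k))) refl (*-monoˡ-∣ (+ (p ℕ.^ k)) p∣c)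
      where
      instance
        _ = prime⇒nonZero pr
        _ = ℕ.m^n≢0 p k
      p∣c : + p ∣ c
      p∣c = cancel {a} p∤a (*-cancelʳ-∣ (+ (p ℕ.^ k)) (divides q
        (trans (*-assoc a c _) (trans eq (cong (q *_) (pos-* p (p ℕ.^ k)))))))

    p∣m!⇒p≤m : ∀ m → p ℕ.∣ m ! → p ℕ.≤ m
    p∣m!⇒p≤m zero    d = contradiction (ℕ.∣1⇒≡1 d) (ℕ.nonTrivial⇒≢1 ⦃ prime⇒nonTrivial pr ⦄)
    p∣m!⇒p≤m (suc m) d with euclidsLemma (suc m) (m !) pr d
    ... | inj₁ p∣1+m = ℕ.∣⇒≤ p∣1+m
    ... | inj₂ p∣m!  = ℕ.m≤n⇒m≤1+n (p∣m!⇒p≤m m p∣m!)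

    -- p divides p! = (p C k) k! (p - k)!, whereas all factors of the other two factorials are
    -- smaller than p.
    p∣pCk : ∀ k → 0 ℕ.< k → k ℕ.< p → p ℕ.∣ p C k
    p∣pCk k 0<k k<p with euclidsLemma (p C k) _ pr (subst (p ℕ.∣_) (sym expand) p∣p!)
      where
      k≤p = ℕ.<⇒≤ k<p
      instance
        _ = prime⇒nonZero pr
        _ = k ℕ.!* (p ℕ.∸ k) !≢0
      expand : (p C k) ℕ.* (k ! ℕ.* (p ℕ.∸ k) !) ≡ p !
      expand = trans (cong (λ c → c ℕ.* (k ! ℕ.* (p ℕ.∸ k) !)) (nCk≡n!/k![n-k]! k≤p)) (m/n*n≡m (k![n∸k]!∣n! k≤p))
      p∣p! : p ℕ.∣ p !
      p∣p! = subst (λ q → q ℕ.∣ q !) (ℕ.suc-pred p) (ℕ.m∣m*n (ℕ.pred p !))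
    ... | inj₁ p∣C = p∣C
    ... | inj₂ p∣k![p-k]! with euclidsLemma (k !) _ pr p∣k![p-k]!
    ...   | inj₁ p∣k!     = contradiction (p∣m!⇒p≤m k p∣k!) (ℕ.<⇒≱ k<p)
    ...   | inj₂ p∣[p-k]! = contradiction (p∣m!⇒p≤m _ p∣[p-k]!)
      (ℕ.<⇒≱ (ℕ.∸-monoʳ-< {p} 0<k (ℕ.<⇒≤ k<p)))

  ·≡* : ∀ n x → n · x ≡ + n * x
  ·≡* zero    x = refl
  ·≡* (suc n) x = trans (cong (λ y → x + y) (·≡* n x)) (sym (suc-* (+ n) x))

  ∣-sum : ∀ {m} n (t : Fin n → ℤ) → (∀ i → m ∣ t i) → m ∣ sum t
  ∣-sum zero    t m∣t = divides (+ 0) refl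
  ∣-sum (suc n) t m∣t = ∣m∣n⇒∣m+n (m∣t fzero) (∣-sum n (t ∘ fsuc) (m∣t ∘ fsuc))

  1^n≡1 : ∀ n → (+ 1) ^ n ≡ + 1
  1^n≡1 zero    = refl
  1^n≡1 (suc n) = trans (*-identityˡ _) (1^n≡1 n)

  module _ {p-1 : ℕ} (pr : Prime (suc p-1)) where

    private
      p = suc p-1

    -- The outer binomial terms are xᵖ and 1; all others carry a coefficient divisible by p. The
    -- summand 1 matches the unit steps of the induction in `fermat`.
    freshman : ∀ x → + p ∣ (+ 1 + x) ^ p - (+ 1 + x ^ p)
    freshman x = subst (+ p ∣_) (sym collect) (∣-sum _ _ middle)
      where
      term : Fin (suc p) → ℤ
      term = Binomial.binomialTerm +-*-commutativeSemiring (+ 1) x p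

      middle : ∀ i → + p ∣ term (fsuc (inject₁ i))
      middle i = subst (+ p ∣_) (sym (·≡* (p C k) _))
        (∣m⇒∣m*n {m = + (p C k)} _ (∣ᵤ⇒∣ (p∣pCk pr k (ℕ.s≤s ℕ.z≤n) (ℕ.s≤s k≤))))
        where
        k = suc (toℕ (inject₁ i))
        k≤ : k ℕ.≤ p-1
        k≤ = subst (ℕ._< p-1) (sym (toℕ-inject₁ i)) (toℕ<n i)

      first : term fzero ≡ x ^ p
      first = trans (·≡* 1 _) (trans (*-identityˡ _) (*-identityˡ _))

      last : term (fsuc (fromℕ p-1)) ≡ + 1
      last rewrite toℕ-fromℕ p-1 | nCn≡1 p | ℕ.n∸n≡0 p-1 = trans (+-identityʳ _) (trans (*-identityʳ _) (1^n≡1 p))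

      collect : (+ 1 + x) ^ p - (+ 1 + x ^ p) ≡ sum (λ i → term (fsuc (inject₁ i)))
      collect = begin
        (+ 1 + x) ^ p - (+ 1 + x ^ p)
          ≡⟨ cong (_- (+ 1 + x ^ p)) (Binomial.theorem +-*-commutativeSemiring p (+ 1) x) ⟩
        term fzero + sum (term ∘ fsuc) - (+ 1 + x ^ p)
          ≡⟨ cong₂ (λ a b → a + b - (+ 1 + x ^ p)) first
               (trans (sum-init-last (term ∘ fsuc)) (cong (λ l → sum (λ i → term (fsuc (inject₁ i))) + l) last)) ⟩
        x ^ p + (sum (λ i → term (fsuc (inject₁ i))) + + 1) - (+ 1 + x ^ p)
          ≡⟨ cancels (x ^ p) _ ⟩
        sum (λ i → term (fsuc (inject₁ i))) ∎
        where
        cancels : ∀ a s → a + (s + + 1) - (+ 1 + a) ≡ s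
        cancels = solve-∀

    fermat : ∀ x → + p ∣ x ^ p - x
    fermat = ℤ-ind _ (divides (+ 0) refl)
      (λ x → subst (+ p ∣_) (up x ((+ 1 + x) ^ p) (x ^ p)) ∘ ∣m∣n⇒∣m+n (freshman x))
      (λ x → subst (+ p ∣_) (down x ((+ 1 + x) ^ p) (x ^ p)) ∘ λ d → ∣m∣n⇒∣m-n d (freshman x))
      where
      up : ∀ x y z → y - (+ 1 + z) + (z - x) ≡ y - (+ 1 + x)
      up = solve-∀
      down : ∀ x y z → y - (+ 1 + x) - (y - (+ 1 + z)) ≡ z - x
      down = solve-∀

    fermat′ : ∀ {x} → ¬ + p ∣ x → + p ∣ x ^ p-1 - + 1
    fermat′ {x} p∤x = cancel pr p∤x (subst (+ p ∣_) (factor x (x ^ p-1)) (fermat x))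
      where
      factor : ∀ x y → x * y - x ≡ x * (y - + 1)
      factor = solve-∀

  -- The ring ℤ[θ], θ³ = θ² + θ + 1

  record Triple (A : Set) : Set where
    constructor ⟨_,_,_⟩
    field
      c₀ c₁ c₂ : A

  open Triple

  ≡-coordinates : ∀ {A} {x y : Triple A} → c₀ x ≡ c₀ y → c₁ x ≡ c₁ y → c₂ x ≡ c₂ y → x ≡ y
  ≡-coordinates refl refl refl = refl

  module CubicOps {A : Set} (_+_ _*_ : A → A → A) (-_ : A → A) where

    infixl 6 _⊹_
    infixl 7 _✶_
    infix  8 ⊟_

    -- `s₃` and `s₄` are the coefficients of θ³ and θ⁴ in the unreduced product, folded back by θ³ =
    -- 1 + θ + θ² and θ⁴ = 1 + 2θ + 2θ².
    _⊹_ _✶_ : Triple A → Triple A → Triple A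
    ⟨ a , b , c ⟩ ⊹ ⟨ x , y , z ⟩ = ⟨ a + x , b + y , c + z ⟩
    ⟨ a , b , c ⟩ ✶ ⟨ x , y , z ⟩ =
      ⟨ (a * x) + (s₃ + s₄) , ((a * y) + (b * x)) + (s₃ + (s₄ + s₄)) , ((a * z) + ((b * y) + (c * x))) + (s₃ + (s₄ + s₄)) ⟩
      where
      s₃ = (b * z) + (c * y)
      s₄ = c * z

    ⊟_ : Triple A → Triple A
    ⊟ ⟨ a , b , c ⟩ = ⟨ - a , - b , - c ⟩

    -- Multiplication by ⟨ a , b , c ⟩ = a + bθ + cθ² has matrix (a b c | c q d | d r s); these are the
    -- coefficients of its characteristic polynomial X³ − tr X² + e₂ X − nm.
    tr e₂ nm : Triple A → A
    tr ⟨ a , b , c ⟩ = a + ((a + c) + (a + (b + (c + c))))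
    e₂ ⟨ a , b , c ⟩ = ((a * q) + (- (b * c))) + (((a * s) + (- (c * d))) + ((q * s) + (- (d * r))))
      where
      d = b + c
      q = a + c
      r = b + (c + c)
      s = a + (b + (c + c))
    nm ⟨ a , b , c ⟩ =
      (a * ((q * s) + (- (d * r)))) + ((- (b * ((c * s) + (- (d * d))))) + (c * ((c * r) + (- (q * d)))))
      where
      d = b + c
      q = a + c
      r = b + (c + c)
      s = a + (b + (c + c))

  ℤ[θ] : Set
  ℤ[θ] = Triple ℤ

  ι : ℤ → ℤ[θ]
  ι n = ⟨ n , + 0 , + 0 ⟩

  -- θ is a unit because θ(θ² - θ - 1) = 1.
  θ θ⁻¹ : ℤ[θ]
  θ   = ⟨ + 0 , + 1 , + 0 ⟩
  θ⁻¹ = ⟨ - (+ 1) , - (+ 1) , + 1 ⟩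

  -- The same formulas on solver expressions let the ring solver for ℤ prove identities between triples.
  module Formal {n} = CubicOps {Expr ℤ n} _⊕_ _⊗_ ⊝_
  open Formal using () renaming (_⊹_ to _⊹′_; _✶_ to _✶′_; tr to tr′; e₂ to e₂′; nm to nm′)
  open CubicOps _+_ _*_ -_

  ι′ : ∀ {n} → Expr ℤ n → Triple (Expr ℤ n)
  ι′ m = ⟨ m , Κ (+ 0) , Κ (+ 0) ⟩

  θ′ : ∀ {n} → Triple (Expr ℤ n)
  θ′ = ⟨ Κ (+ 0) , Κ (+ 1) , Κ (+ 0) ⟩

  ✶-assoc : ∀ x y z → (x ✶ y) ✶ z ≡ x ✶ (y ✶ z)
  ✶-assoc ⟨ a , b , c ⟩ ⟨ d , e , f ⟩ ⟨ g , h , i ⟩ = ≡-coordinates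
    (solveℤ 9 (λ a b c d e f g h i → let x = ⟨ a , b , c ⟩ ; y = ⟨ d , e , f ⟩ ; z = ⟨ g , h , i ⟩
      in c₀ ((x ✶′ y) ✶′ z) ⊜ c₀ (x ✶′ (y ✶′ z))) refl a b c d e f g h i)
    (solveℤ 9 (λ a b c d e f g h i → let x = ⟨ a , b , c ⟩ ; y = ⟨ d , e , f ⟩ ; z = ⟨ g , h , i ⟩
      in c₁ ((x ✶′ y) ✶′ z) ⊜ c₁ (x ✶′ (y ✶′ z))) refl a b c d e f g h i)
    (solveℤ 9 (λ a b c d e f g h i → let x = ⟨ a , b , c ⟩ ; y = ⟨ d , e , f ⟩ ; z = ⟨ g , h , i ⟩
      in c₂ ((x ✶′ y) ✶′ z) ⊜ c₂ (x ✶′ (y ✶′ z))) refl a b c d e f g h i)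

  ✶-comm : ∀ x y → x ✶ y ≡ y ✶ x
  ✶-comm ⟨ a , b , c ⟩ ⟨ d , e , f ⟩ = ≡-coordinates
    (solveℤ 6 (λ a b c d e f → let x = ⟨ a , b , c ⟩ ; y = ⟨ d , e , f ⟩
      in c₀ (x ✶′ y) ⊜ c₀ (y ✶′ x)) refl a b c d e f)
    (solveℤ 6 (λ a b c d e f → let x = ⟨ a , b , c ⟩ ; y = ⟨ d , e , f ⟩
      in c₁ (x ✶′ y) ⊜ c₁ (y ✶′ x)) refl a b c d e f)
    (solveℤ 6 (λ a b c d e f → let x = ⟨ a , b , c ⟩ ; y = ⟨ d , e , f ⟩
      in c₂ (x ✶′ y) ⊜ c₂ (y ✶′ x)) refl a b c d e f)

  ✶-distribˡ-⊹ : ∀ x y z → x ✶ (y ⊹ z) ≡ (x ✶ y) ⊹ (x ✶ z)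
  ✶-distribˡ-⊹ ⟨ a , b , c ⟩ ⟨ d , e , f ⟩ ⟨ g , h , i ⟩ = ≡-coordinates
    (solveℤ 9 (λ a b c d e f g h i → let x = ⟨ a , b , c ⟩ ; y = ⟨ d , e , f ⟩ ; z = ⟨ g , h , i ⟩
      in c₀ (x ✶′ (y ⊹′ z)) ⊜ c₀ ((x ✶′ y) ⊹′ (x ✶′ z))) refl a b c d e f g h i)
    (solveℤ 9 (λ a b c d e f g h i → let x = ⟨ a , b , c ⟩ ; y = ⟨ d , e , f ⟩ ; z = ⟨ g , h , i ⟩
      in c₁ (x ✶′ (y ⊹′ z)) ⊜ c₁ ((x ✶′ y) ⊹′ (x ✶′ z))) refl a b c d e f g h i)
    (solveℤ 9 (λ a b c d e f g h i → let x = ⟨ a , b , c ⟩ ; y = ⟨ d , e , f ⟩ ; z = ⟨ g , h , i ⟩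
      in c₂ (x ✶′ (y ⊹′ z)) ⊜ c₂ ((x ✶′ y) ⊹′ (x ✶′ z))) refl a b c d e f g h i)

  ✶-identityˡ : ∀ x → ι (+ 1) ✶ x ≡ x
  ✶-identityˡ ⟨ a , b , c ⟩ = ≡-coordinates
    (solveℤ 3 (λ a b c → let x = ⟨ a , b , c ⟩ in c₀ (ι′ (Κ (+ 1)) ✶′ x) ⊜ c₀ x) refl a b c)
    (solveℤ 3 (λ a b c → let x = ⟨ a , b , c ⟩ in c₁ (ι′ (Κ (+ 1)) ✶′ x) ⊜ c₁ x) refl a b c)
    (solveℤ 3 (λ a b c → let x = ⟨ a , b , c ⟩ in c₂ (ι′ (Κ (+ 1)) ✶′ x) ⊜ c₂ x) refl a b c)

  ℤ[θ]-commutativeRing : CommutativeRing 0ℓ 0ℓ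
  ℤ[θ]-commutativeRing = record
    { Carrier = ℤ[θ]
    ; _≈_ = _≡_
    ; _+_ = _⊹_
    ; _*_ = _✶_
    ; -_ = ⊟_
    ; 0# = ι (+ 0)
    ; 1# = ι (+ 1)
    ; isCommutativeRing = record
      { isRing = record
        { +-isAbelianGroup = record
          { isGroup = record
            { isMonoid = record
              { isSemigroup = record
                { isMagma = record { isEquivalence = isEquivalence ; ∙-cong = cong₂ _⊹_ }
                ; assoc = λ x y z → ≡-coordinates (+-assoc (c₀ x) (c₀ y) (c₀ z)) (+-assoc (c₁ x) (c₁ y) (c₁ z)) (+-assoc (c₂ x) (c₂ y) (c₂ z))
                }
              ; identity = (λ x → ≡-coordinates (+-identityˡ _) (+-identityˡ _) (+-identityˡ _))
                         , (λ x → ≡-coordinates (+-identityʳ _) (+-identityʳ _) (+-identityʳ _))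
              }
            ; inverse = (λ x → ≡-coordinates (+-inverseˡ (c₀ x)) (+-inverseˡ (c₁ x)) (+-inverseˡ (c₂ x)))
                      , (λ x → ≡-coordinates (+-inverseʳ (c₀ x)) (+-inverseʳ (c₁ x)) (+-inverseʳ (c₂ x)))
            ; ⁻¹-cong = cong ⊟_
            }
          ; comm = λ x y → ≡-coordinates (+-comm (c₀ x) (c₀ y)) (+-comm (c₁ x) (c₁ y)) (+-comm (c₂ x) (c₂ y))
          }
        ; *-cong = cong₂ _✶_
        ; *-assoc = ✶-assoc
        ; *-identity = comm∧idˡ⇒id ✶-comm ✶-identityˡ
        ; distrib = comm∧distrˡ⇒distr (cong₂ _⊹_) ✶-comm ✶-distribˡ-⊹
        }
      ; *-comm = ✶-comm
      }
    }

  ℤ[θ]-ring : AlmostCommutativeRing 0ℓ 0ℓ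
  ℤ[θ]-ring = fromCommutativeRing ℤ[θ]-commutativeRing
    λ { ⟨ + 0 , + 0 , + 0 ⟩ → just refl ; _ → nothing }

  open NonReflective ℤ[θ]-ring using () renaming (solve to solveθ; _⊜_ to _≜_)

  cayley-hamilton : ∀ x → (x ✶ (x ✶ x)) ⊹ (ι (e₂ x) ✶ x) ≡ (ι (tr x) ✶ (x ✶ x)) ⊹ ι (nm x)
  cayley-hamilton ⟨ a , b , c ⟩ = ≡-coordinates
    (solveℤ 3 (λ a b c → let x = ⟨ a , b , c ⟩ in
      c₀ ((x ✶′ (x ✶′ x)) ⊹′ (ι′ (e₂′ x) ✶′ x)) ⊜ c₀ ((ι′ (tr′ x) ✶′ (x ✶′ x)) ⊹′ ι′ (nm′ x))) refl a b c)
    (solveℤ 3 (λ a b c → let x = ⟨ a , b , c ⟩ in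
      c₁ ((x ✶′ (x ✶′ x)) ⊹′ (ι′ (e₂′ x) ✶′ x)) ⊜ c₁ ((ι′ (tr′ x) ✶′ (x ✶′ x)) ⊹′ ι′ (nm′ x))) refl a b c)
    (solveℤ 3 (λ a b c → let x = ⟨ a , b , c ⟩ in
      c₂ ((x ✶′ (x ✶′ x)) ⊹′ (ι′ (e₂′ x) ✶′ x)) ⊜ c₂ ((ι′ (tr′ x) ✶′ (x ✶′ x)) ⊹′ ι′ (nm′ x))) refl a b c)

  -- Newton's identity for the sum of the cubes of the three eigenvalues of multiplication by x.
  tr-cube : ∀ x → tr (x ✶ (x ✶ x)) ≡ tr x * tr x * tr x - + 3 * tr x * e₂ x + + 3 * nm x
  tr-cube ⟨ a , b , c ⟩ = solveℤ 3 (λ a b c → let x = ⟨ a , b , c ⟩ ; t = tr′ x ; e = e₂′ x in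
    tr′ (x ✶′ (x ✶′ x)) ⊜ (t ⊗ t ⊗ t ⊕ (⊝ (Κ (+ 3) ⊗ t ⊗ e)) ⊕ Κ (+ 3) ⊗ nm′ x)) refl a b c

  -- Newton's identity again, now for the pairwise products of the eigenvalues; their elementary
  -- symmetric functions are `e₂ x`, `tr x * nm x` and the square of `nm x`.
  e₂-cube : ∀ x → e₂ (x ✶ (x ✶ x)) ≡ e₂ x * e₂ x * e₂ x - + 3 * tr x * e₂ x * nm x + + 3 * nm x * nm x
  e₂-cube ⟨ a , b , c ⟩ = solveℤ 3 (λ a b c → let x = ⟨ a , b , c ⟩ ; e = e₂′ x ; n = nm′ x in
    e₂′ (x ✶′ (x ✶′ x)) ⊜ (e ⊗ e ⊗ e ⊕ (⊝ (Κ (+ 3) ⊗ tr′ x ⊗ e ⊗ n)) ⊕ Κ (+ 3) ⊗ n ⊗ n)) refl a b c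

  nm-θ : ∀ x → nm (θ ✶ x) ≡ nm x
  nm-θ ⟨ a , b , c ⟩ = solveℤ 3 (λ a b c → let x = ⟨ a , b , c ⟩ in nm′ (θ′ ✶′ x) ⊜ (nm′ x)) refl a b c

  tr-near-θ : ∀ m x → tr (θ ⊹ (ι m ✶ x)) ≡ + 1 + m * tr x
  tr-near-θ m ⟨ a , b , c ⟩ = solveℤ 4 (λ m a b c → let x = ⟨ a , b , c ⟩ in
    tr′ (θ′ ⊹′ (ι′ m ✶′ x)) ⊜ (Κ (+ 1) ⊕ m ⊗ tr′ x)) refl m a b c

  -- From χ, θ has trace 1 and second symmetric function -1; the term linear in m is the
  -- polarisation tr θ tr x - tr (θx).
  e₂-near-θ : ∀ m x → e₂ (θ ⊹ (ι m ✶ x)) ≡ - (+ 1) + m * (tr x - tr (θ ✶ x) + m * e₂ x)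
  e₂-near-θ m ⟨ a , b , c ⟩ = solveℤ 4 (λ m a b c → let x = ⟨ a , b , c ⟩ in
    e₂′ (θ′ ⊹′ (ι′ m ✶′ x)) ⊜ ((⊝ (Κ (+ 1))) ⊕ m ⊗ (tr′ x ⊕ (⊝ (tr′ (θ′ ✶′ x))) ⊕ m ⊗ e₂′ x))) refl m a b c

  -- The powers of θ and the Tribonacci numbers

  -- Θ n = θⁿ: the coefficient of θ² in θⁿ is T (n − 1).
  Θ : ℤ → ℤ[θ]
  Θ n = ⟨ T (n - + 2) , T n - T (n - + 1) , T (n - + 1) ⟩

  θ-shift : ∀ a b c → θ ✶ ⟨ a , b , c ⟩ ≡ ⟨ c , a + c , b + c ⟩
  θ-shift a b c = ≡-coordinates (shift₀ a b c) (shift₁ a b c) (shift₂ a b c)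
    where
    shift₀ : ∀ a b c → + 0 * a + (+ 1 * c + + 0 * b + + 0 * c) ≡ c
    shift₀ = solve-∀
    shift₁ : ∀ a b c → + 0 * b + + 1 * a + (+ 1 * c + + 0 * b + (+ 0 * c + + 0 * c)) ≡ a + c
    shift₁ = solve-∀
    shift₂ : ∀ a b c → + 0 * c + (+ 1 * b + + 0 * a) + (+ 1 * c + + 0 * b + (+ 0 * c + + 0 * c)) ≡ b + c
    shift₂ = solve-∀

  Θ-suc : ∀ n → Θ (+ 1 + n) ≡ θ ✶ Θ n
  Θ-suc n = sym (trans (θ-shift (T (n - + 2)) (T n - T (n - + 1)) (T (n - + 1))) (≡-coordinates
    (cong T (shift₁ n))
    (trans (regroup (T (n - + 2)) (T (n - + 1)) (T n)) (cong₂ _-_ (sym recurrence) (cong T (shift₂ n))))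
    (trans (cancels (T (n - + 1)) (T n)) (cong T (shift₂ n)))))
    where
    shift₁ : ∀ n → n - + 1 ≡ + 1 + n - + 2
    shift₁ = solve-∀
    shift₂ : ∀ n → n ≡ + 1 + n - + 1
    shift₂ = solve-∀
    shift₃ : ∀ n → + 1 + n ≡ n - + 2 + + 3
    shift₃ = solve-∀
    shift₄ : ∀ n → n - + 2 + + 2 ≡ n
    shift₄ = solve-∀
    shift₅ : ∀ n → n - + 2 + + 1 ≡ n - + 1
    shift₅ = solve-∀
    cancels : ∀ b c → c - b + b ≡ c
    cancels = solve-∀
    regroup : ∀ a b c → a + b ≡ c + b + a - c
    regroup = solve-∀
    recurrence : T (+ 1 + n) ≡ T n + T (n - + 1) + T (n - + 2)
    recurrence = trans (cong T (shift₃ n)) (trans (T-recurrence (n - + 2))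
      (cong₂ (λ i j → T i + T j + T (n - + 2)) (shift₄ n) (shift₅ n)))

  θ-cancel : ∀ {x y} → θ ✶ x ≡ θ ✶ y → x ≡ y
  θ-cancel {x} {y} eq = begin
    -- The product `θ⁻¹ ✶ θ` evaluates to `ι (+ 1)`, so the identity law applies directly.
    x               ≡⟨ ✶-identityˡ x ⟨
    θ⁻¹ ✶ θ ✶ x     ≡⟨ ✶-assoc θ⁻¹ θ x ⟩
    θ⁻¹ ✶ (θ ✶ x)   ≡⟨ cong (θ⁻¹ ✶_) eq ⟩
    θ⁻¹ ✶ (θ ✶ y)   ≡⟨ ✶-assoc θ⁻¹ θ y ⟨
    θ⁻¹ ✶ θ ✶ y     ≡⟨ ✶-identityˡ y ⟩
    y               ∎

  -- Induction on m by factors of θ; downwards the factor is cancelled, so negative indices need no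
  -- separate formula.
  Θ-+ : ∀ m n → Θ (m + n) ≡ Θ m ✶ Θ n
  Θ-+ m n = ℤ-ind (λ m → Θ (m + n) ≡ Θ m ✶ Θ n)
    (trans (cong Θ (+-identityˡ n)) (sym (✶-identityˡ (Θ n))))
    (λ m eq → trans (up m) (trans (cong (θ ✶_) eq) (sym (right m))))
    (λ m eq → θ-cancel (trans (sym (up m)) (trans eq (right m))))
    m
    where
    up : ∀ m → Θ (+ 1 + m + n) ≡ θ ✶ Θ (m + n)
    up m = trans (cong Θ (+-assoc (+ 1) m n)) (Θ-suc (m + n))
    right : ∀ m → Θ (+ 1 + m) ✶ Θ n ≡ θ ✶ (Θ m ✶ Θ n)
    right m = trans (cong (_✶ Θ n) (Θ-suc m)) (✶-assoc θ (Θ m) (Θ n))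

  nm-Θ : ∀ n → nm (Θ n) ≡ + 1
  nm-Θ = ℤ-ind _ refl
    (λ n eq → trans (step n) eq)
    (λ n eq → trans (sym (step n)) eq)
    where
    step : ∀ n → nm (Θ (+ 1 + n)) ≡ nm (Θ n)
    step n = trans (cong nm (Θ-suc n)) (nm-θ (Θ n))

  -- Powers of θ congruent to 1 modulo prime powers

  One-mod : ℤ → ℤ[θ] → Set
  One-mod m x = ∃[ z ] x ≡ ι (+ 1) ⊹ (ι m ✶ z)

  -- The downward step avoids inverting 1 + mz: any y equals (1 + mz)y - mzy, and for y = θ^(tn) the
  -- first summand is the power already known to be 1 modulo m.
  Θ-one-mod-multiples : ∀ {m n} → One-mod m (Θ n) → ∀ t → One-mod m (Θ (t * n))
  Θ-one-mod-multiples {m} {n} (z , eq) = ℤ-ind _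
    (ι (+ 0) , sym (zeroʳ (ι m)))
    (λ t (z′ , eq′) → _ , trans (step t) (trans (cong₂ _✶_ eq eq′) (forward (ι m) z z′)))
    (λ t (z′ , eq′) → _ , trans (backward (ι m) z (Θ (t * n)))
      (trans (cong (_⊹ (ι m ✶ (⊟ (z ✶ Θ (t * n))))) (trans (cong (_✶ Θ (t * n)) (sym eq)) (trans (sym (step t)) eq′)))
        (collect (ι m) z′ (⊟ (z ✶ Θ (t * n))))))
    where
    step : ∀ t → Θ ((+ 1 + t) * n) ≡ Θ n ✶ Θ (t * n)
    step t = trans (cong Θ (suc-* t n)) (Θ-+ n (t * n))
    zeroʳ : ∀ m → ι (+ 1) ⊹ (m ✶ ι (+ 0)) ≡ ι (+ 1)
    zeroʳ = solveθ 1 (λ m → (Κ (ι (+ 1)) ⊕ (m ⊗ Κ (ι (+ 0)))) ≜ Κ (ι (+ 1))) refl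
    forward : ∀ m z z′ → (ι (+ 1) ⊹ (m ✶ z)) ✶ (ι (+ 1) ⊹ (m ✶ z′)) ≡ ι (+ 1) ⊹ (m ✶ (z ⊹ (z′ ⊹ (m ✶ (z ✶ z′)))))
    forward = solveθ 3 (λ m z z′ → ((Κ (ι (+ 1)) ⊕ (m ⊗ z)) ⊗ (Κ (ι (+ 1)) ⊕ (m ⊗ z′)))
      ≜ (Κ (ι (+ 1)) ⊕ (m ⊗ (z ⊕ (z′ ⊕ (m ⊗ (z ⊗ z′))))))) refl
    backward : ∀ m z y → y ≡ ((ι (+ 1) ⊹ (m ✶ z)) ✶ y) ⊹ (m ✶ (⊟ (z ✶ y)))
    backward = solveθ 3 (λ m z y → y ≜ (((Κ (ι (+ 1)) ⊕ (m ⊗ z)) ⊗ y) ⊕ (m ⊗ (⊝ (z ⊗ y))))) refl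
    collect : ∀ m z y → ι (+ 1) ⊹ (m ✶ z) ⊹ (m ✶ y) ≡ ι (+ 1) ⊹ (m ✶ (z ⊹ y))
    collect = solveθ 3 (λ m z y → (Κ (ι (+ 1)) ⊕ (m ⊗ z) ⊕ (m ⊗ y)) ≜ (Κ (ι (+ 1)) ⊕ (m ⊗ (z ⊕ y)))) refl

  ι-* : ∀ a b → ι (a * b) ≡ ι a ✶ ι b
  ι-* a b = ≡-coordinates (scalar₀ a b) (scalar₁ a b) (scalar₁ a b)
    where
    scalar₀ : ∀ a b → a * b ≡ a * b + (+ 0 * + 0 + + 0 * b + + 0 * + 0)
    scalar₀ = solve-∀
    scalar₁ : ∀ a b → + 0 ≡ a * + 0 + + 0 * b + (+ 0 * + 0 + + 0 * + 0 + (+ 0 * + 0 + + 0 * + 0))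
    scalar₁ = solve-∀

  -- The expansion of (1 + mz)ʲ to first order. The cofactor j + mh is kept explicit, since for j =
  -- p it supplies one more factor p.
  Θ-multiple : ∀ {m n z} → Θ n ≡ ι (+ 1) ⊹ ι m ✶ z →
    ∀ j → ∃[ h ] Θ (+ j * n) ≡ ι (+ 1) ⊹ ι m ✶ z ✶ (ι (+ j) ⊹ ι m ✶ h)
  Θ-multiple {m} {n} {z} eq zero    = ι (+ 0) , base (ι m) z
    where
    base : ∀ m z → ι (+ 1) ≡ ι (+ 1) ⊹ m ✶ z ✶ (ι (+ 0) ⊹ m ✶ ι (+ 0))
    base = solveθ 2 (λ m z → Κ (ι (+ 1)) ≜ (Κ (ι (+ 1)) ⊕ m ⊗ z ⊗ (Κ (ι (+ 0)) ⊕ m ⊗ Κ (ι (+ 0))))) refl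
  Θ-multiple {m} {n} {z} eq (suc j) with Θ-multiple {m} {n} {z} eq j
  ... | h , eq′ = h ⊹ z ✶ g , (begin
    Θ (+ suc j * n)                                ≡⟨ cong Θ (suc-* (+ j) n) ⟩
    Θ (n + + j * n)                                ≡⟨ Θ-+ n (+ j * n) ⟩
    Θ n ✶ Θ (+ j * n)                              ≡⟨ cong₂ _✶_ eq eq′ ⟩
    (ι (+ 1) ⊹ e) ✶ (ι (+ 1) ⊹ e ✶ g)              ≡⟨ expand e g ⟩
    ι (+ 1) ⊹ e ✶ (ι (+ 1) ⊹ g ⊹ e ✶ g)            ≡⟨ cong (λ s → ι (+ 1) ⊹ e ✶ s) (regroup (ι (+ 1)) (ι (+ j)) (ι m) h z g) ⟩
    ι (+ 1) ⊹ e ✶ (ι (+ suc j) ⊹ ι m ✶ (h ⊹ z ✶ g)) ∎)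
    where
    e = ι m ✶ z
    g = ι (+ j) ⊹ ι m ✶ h
    expand : ∀ e g → (ι (+ 1) ⊹ e) ✶ (ι (+ 1) ⊹ e ✶ g) ≡ ι (+ 1) ⊹ e ✶ (ι (+ 1) ⊹ g ⊹ e ✶ g)
    expand = solveθ 2 (λ e g → ((Κ (ι (+ 1)) ⊕ e) ⊗ (Κ (ι (+ 1)) ⊕ e ⊗ g)) ≜
      (Κ (ι (+ 1)) ⊕ e ⊗ (Κ (ι (+ 1)) ⊕ g ⊕ e ⊗ g))) refl
    regroup : ∀ i j m h z g → i ⊹ (j ⊹ m ✶ h) ⊹ m ✶ z ✶ g ≡ i ⊹ j ⊹ m ✶ (h ⊹ z ✶ g)
    regroup = solveθ 6 (λ i j m h z g → (i ⊕ (j ⊕ m ⊗ h) ⊕ m ⊗ z ⊗ g) ≜ (i ⊕ j ⊕ m ⊗ (h ⊕ z ⊗ g))) refl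

  -- Each p-th power raises the modulus by one factor p: with m = pᵏ⁺¹ the cofactor p + mh of
  -- `Θ-multiple` is divisible by p.
  Θ-one-mod-lift : ∀ p {n} → One-mod (+ p) (Θ n) → ∀ k → One-mod (+ (p ℕ.^ suc k)) (Θ (+ (p ℕ.^ k) * n))
  Θ-one-mod-lift p {n} one zero = subst₂ (λ m n → One-mod m (Θ n)) (cong +_ (sym (ℕ.*-identityʳ p))) (sym (*-identityˡ n)) one
  Θ-one-mod-lift p {n} one (suc k) with Θ-one-mod-lift p one k
  ... | z , eq with Θ-multiple {+ (p ℕ.^ suc k)} {+ (p ℕ.^ k) * n} {z} eq p
  ...   | h , eq′ = z ⊹ z ✶ q ✶ h , (begin
    Θ (+ (p ℕ.* p ℕ.^ k) * n)
      ≡⟨ cong Θ (trans (cong (λ i → i * n) (pos-* p (p ℕ.^ k))) (*-assoc (+ p) (+ (p ℕ.^ k)) n)) ⟩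
    Θ (+ p * (+ (p ℕ.^ k) * n))
      ≡⟨ eq′ ⟩
    ι (+ 1) ⊹ M ✶ z ✶ (ι (+ p) ⊹ M ✶ h)
      ≡⟨ cong (λ s → ι (+ 1) ⊹ M ✶ z ✶ (ι (+ p) ⊹ s ✶ h)) (split (p ℕ.^ k)) ⟩
    ι (+ 1) ⊹ M ✶ z ✶ (ι (+ p) ⊹ ι (+ p) ✶ q ✶ h)
      ≡⟨ cong (ι (+ 1) ⊹_) (collect (ι (+ p)) M z q h) ⟩
    ι (+ 1) ⊹ ι (+ p) ✶ M ✶ (z ⊹ z ✶ q ✶ h)
      ≡⟨ cong (λ s → ι (+ 1) ⊹ s ✶ (z ⊹ z ✶ q ✶ h)) (sym (split (p ℕ.^ suc k))) ⟩
    ι (+ 1) ⊹ ι (+ (p ℕ.^ suc (suc k))) ✶ (z ⊹ z ✶ q ✶ h) ∎)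
    where
    q = ι (+ (p ℕ.^ k))
    M = ι (+ (p ℕ.^ suc k))
    split : ∀ q → ι (+ (p ℕ.* q)) ≡ ι (+ p) ✶ ι (+ q)
    split q = trans (cong ι (pos-* p q)) (ι-* (+ p) (+ q))
    collect : ∀ p m z q h → m ✶ z ✶ (p ⊹ p ✶ q ✶ h) ≡ p ✶ m ✶ (z ⊹ z ✶ q ✶ h)
    collect = solveθ 5 (λ p m z q h → (m ⊗ z ⊗ (p ⊕ p ⊗ q ⊗ h)) ≜ (p ⊗ m ⊗ (z ⊕ z ⊗ q ⊗ h))) refl

  c₂-ι : ∀ m x → c₂ (ι m ✶ x) ≡ m * c₂ x
  c₂-ι m ⟨ a , b , c ⟩ = scalar m a b c
    where
    scalar : ∀ m a b c → m * c + (+ 0 * b + + 0 * a) + (+ 0 * c + + 0 * b + (+ 0 * c + + 0 * c)) ≡ m * c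
    scalar = solve-∀

  c₂-θ : ∀ x → c₂ (x ✶ θ) ≡ c₁ x + c₂ x
  c₂-θ ⟨ a , b , c ⟩ = coordinate a b c
    where
    coordinate : ∀ a b c → a * + 0 + (b * + 1 + c * + 0) + (b * + 0 + c * + 1 + (c * + 0 + c * + 0)) ≡ b + c
    coordinate = solve-∀

  c₂-θ⁻¹ : ∀ x → c₂ (x ✶ θ⁻¹) ≡ c₀ x
  c₂-θ⁻¹ ⟨ a , b , c ⟩ = coordinate a b c
    where
    coordinate : ∀ a b c → a * + 1 + (b * - (+ 1) + c * - (+ 1)) + (b * + 1 + c * - (+ 1) + (c * + 1 + c * + 1)) ≡ a
    coordinate = solve-∀

  -- A cube root of θ modulo m

  module _ {m : ℤ} (n : ℤ) (z : ℤ[θ]) (cube : Θ n ✶ (Θ n ✶ Θ n) ≡ θ ⊹ ι m ✶ z) where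

    private
      x : ℤ[θ]
      x = Θ n
      u v : ℤ
      u = tr x
      v = e₂ x

    -- Traces are compared in x³ = θ + mz, using tr θ = 1 and nm x = 1; `newton-v` does the same
    -- with `e₂` in place of `tr`.
    newton-u : m ∣ u * u * u - + 3 * u * v + + 2
    newton-u = divides (tr z) (begin
      u * u * u - + 3 * u * v + + 2                   ≡⟨ shift (u * u * u - + 3 * u * v) ⟩
      u * u * u - + 3 * u * v + + 3 * + 1 - + 1       ≡⟨ cong (λ i → u * u * u - + 3 * u * v + + 3 * i - + 1) (nm-Θ n) ⟨
      u * u * u - + 3 * u * v + + 3 * nm x - + 1      ≡⟨ cong (_- + 1) (tr-cube x) ⟨
      tr (x ✶ (x ✶ x)) - + 1                          ≡⟨ cong (λ y → tr y - + 1) cube ⟩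
      tr (θ ⊹ ι m ✶ z) - + 1                          ≡⟨ cong (_- + 1) (tr-near-θ m z) ⟩
      + 1 + m * tr z - + 1                            ≡⟨ unshift m (tr z) ⟩
      tr z * m                                        ∎)
      where
      shift : ∀ a → a + + 2 ≡ a + + 3 * + 1 - + 1
      shift = solve-∀
      unshift : ∀ m t → + 1 + m * t - + 1 ≡ t * m
      unshift = solve-∀

    newton-v : m ∣ v * v * v - + 3 * u * v + + 4
    newton-v = divides (tr z - tr (θ ✶ z) + m * e₂ z) (begin
      v * v * v - + 3 * u * v + + 4
        ≡⟨ shift u v ⟩
      v * v * v - + 3 * u * v * + 1 + + 3 * + 1 * + 1 + + 1
        ≡⟨ cong (λ i → v * v * v - + 3 * u * v * i + + 3 * i * i + + 1) (nm-Θ n) ⟨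
      v * v * v - + 3 * u * v * nm x + + 3 * nm x * nm x + + 1
        ≡⟨ cong (_+ + 1) (e₂-cube x) ⟨
      e₂ (x ✶ (x ✶ x)) + + 1
        ≡⟨ cong (λ y → e₂ y + + 1) cube ⟩
      e₂ (θ ⊹ ι m ✶ z) + + 1
        ≡⟨ cong (_+ + 1) (e₂-near-θ m z) ⟩
      - (+ 1) + m * (tr z - tr (θ ✶ z) + m * e₂ z) + + 1
        ≡⟨ unshift m (tr z - tr (θ ✶ z) + m * e₂ z) ⟩
      (tr z - tr (θ ✶ z) + m * e₂ z) * m ∎)
      where
      shift : ∀ u v → v * v * v - + 3 * u * v + + 4 ≡ v * v * v - + 3 * u * v * + 1 + + 3 * + 1 * + 1 + + 1
      shift = solve-∀
      unshift : ∀ m t → - (+ 1) + m * t + + 1 ≡ t * m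
      unshift = solve-∀

    private
      α β : ℤ
      α = c₂ x
      β = c₂ (x ✶ x)
      -- `x′` is the adjugate x² - ux + v of x. As x has norm 1, Cayley-Hamilton makes it the
      -- inverse of x.
      U V x′ : ℤ[θ]
      U = ι u
      V = ι v
      x′ = x ✶ x ⊹ ⊟ (U ✶ x) ⊹ V

      reduce : x ✶ (x ✶ x) ≡ U ✶ (x ✶ x) ⊹ ι (+ 1) ⊹ ⊟ (V ✶ x)
      reduce = trans (move (x ✶ (x ✶ x)) (V ✶ x))
        (cong (_⊹ ⊟ (V ✶ x)) (trans (cayley-hamilton x) (cong (λ i → U ✶ (x ✶ x) ⊹ ι i) (nm-Θ n))))
        where
        move : ∀ a b → a ≡ a ⊹ b ⊹ ⊟ b
        move = solveθ 2 (λ a b → a ≜ (a ⊕ b ⊕ ⊝ b)) refl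

      inverse : x ✶ x′ ≡ ι (+ 1)
      inverse = trans (expand x U V) (trans (cong (λ y → y ⊹ ⊟ (U ✶ (x ✶ x)) ⊹ V ✶ x) reduce) (cancels (U ✶ (x ✶ x)) (ι (+ 1)) (V ✶ x)))
        where
        expand : ∀ x U V → x ✶ (x ✶ x ⊹ ⊟ (U ✶ x) ⊹ V) ≡ x ✶ (x ✶ x) ⊹ ⊟ (U ✶ (x ✶ x)) ⊹ V ✶ x
        expand = solveθ 3 (λ x U V → (x ⊗ (x ⊗ x ⊕ ⊝ (U ⊗ x) ⊕ V)) ≜ (x ⊗ (x ⊗ x) ⊕ ⊝ (U ⊗ (x ⊗ x)) ⊕ V ⊗ x)) refl
        cancels : ∀ a b c → a ⊹ b ⊹ ⊟ c ⊹ ⊟ a ⊹ c ≡ b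
        cancels = solveθ 3 (λ a b c → (a ⊕ b ⊕ ⊝ c ⊕ ⊝ a ⊕ c) ≜ b) refl

      -- The θ²-coefficients of x³ = θ + mz and x³ = ux² - vx + 1; neither θ nor 1 contributes.
      cubic-relation : m * c₂ z ≡ u * β + - (v * α)
      cubic-relation = begin
        m * c₂ z                                     ≡⟨ c₂-ι m z ⟨
        c₂ (ι m ✶ z)                                 ≡⟨ +-identityˡ _ ⟨
        c₂ (θ ⊹ ι m ✶ z)                             ≡⟨ cong c₂ (trans (sym cube) reduce) ⟩
        c₂ (U ✶ (x ✶ x)) + + 0 + - c₂ (V ✶ x)        ≡⟨ cong₂ (λ i j → i + + 0 + - j) (c₂-ι u (x ✶ x)) (c₂-ι v x) ⟩
        u * β + + 0 + - (v * α)                      ≡⟨ cong (_+ - (v * α)) (+-identityʳ (u * β)) ⟩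
        u * β + - (v * α)                            ∎

      -- The θ²-coefficient of x⁴, computed twice: as xθ + mxz, where xθ = θⁿ⁺¹ contributes T(n),
      -- and as ux³ + x - vx².
      quartic-relation : T n + m * c₂ (x ✶ z) ≡ u * (m * c₂ z) + α - v * β
      quartic-relation = begin
        T n + m * c₂ (x ✶ z)
          ≡⟨ cong₂ _+_ (trans (rejoin (T n) (T (n - + 1))) (sym (c₂-θ x))) (sym (c₂-ι m (x ✶ z))) ⟩
        c₂ (x ✶ θ) + c₂ (ι m ✶ (x ✶ z))
          ≡⟨ cong c₂ (distribute x θ (ι m) z) ⟨
        c₂ (x ✶ (θ ⊹ ι m ✶ z))
          ≡⟨ cong (λ y → c₂ (x ✶ y)) (trans (sym cube) reduce) ⟩
        c₂ (x ✶ (U ✶ (x ✶ x) ⊹ ι (+ 1) ⊹ ⊟ (V ✶ x)))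
          ≡⟨ cong c₂ (expand x U V) ⟩
        c₂ (U ✶ (x ✶ (x ✶ x))) + α - c₂ (V ✶ (x ✶ x))
          ≡⟨ cong₂ (λ i j → i + α - j) (trans (c₂-ι u (x ✶ (x ✶ x))) (cong (λ y → u * c₂ y) cube)) (c₂-ι v (x ✶ x)) ⟩
        u * (+ 0 + c₂ (ι m ✶ z)) + α - v * β
          ≡⟨ cong (λ i → u * i + α - v * β) (trans (+-identityˡ _) (c₂-ι m z)) ⟩
        u * (m * c₂ z) + α - v * β ∎
        where
        rejoin : ∀ a b → a ≡ a - b + b
        rejoin = solve-∀
        distribute : ∀ x θ m z → x ✶ (θ ⊹ m ✶ z) ≡ x ✶ θ ⊹ m ✶ (x ✶ z)
        distribute = solveθ 4 (λ x θ m z → (x ⊗ (θ ⊕ m ⊗ z)) ≜ (x ⊗ θ ⊕ m ⊗ (x ⊗ z))) refl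
        expand : ∀ x U V → x ✶ (U ✶ (x ✶ x) ⊹ ι (+ 1) ⊹ ⊟ (V ✶ x)) ≡ U ✶ (x ✶ (x ✶ x)) ⊹ x ⊹ ⊟ (V ✶ (x ✶ x))
        expand = solveθ 3 (λ x U V → (x ⊗ (U ⊗ (x ⊗ x) ⊕ Κ (ι (+ 1)) ⊕ ⊝ (V ⊗ x))) ≜ (U ⊗ (x ⊗ (x ⊗ x)) ⊕ x ⊕ ⊝ (V ⊗ (x ⊗ x)))) refl

      inverse-square : x′ ✶ x′ ≡ x ⊹ ⊟ U ⊹ V ✶ x′
      inverse-square = trans (expand x′ V U x) (trans (cong (λ y → y ✶ x ⊹ ⊟ (U ✶ y) ⊹ V ✶ x′) inverse) (simplify x U (V ✶ x′)))
        where
        expand : ∀ y V U x → y ✶ (x ✶ x ⊹ ⊟ (U ✶ x) ⊹ V) ≡ (x ✶ y) ✶ x ⊹ ⊟ (U ✶ (x ✶ y)) ⊹ V ✶ y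
        expand = solveθ 4 (λ y V U x → (y ⊗ (x ⊗ x ⊕ ⊝ (U ⊗ x) ⊕ V)) ≜ ((x ⊗ y) ⊗ x ⊕ ⊝ (U ⊗ (x ⊗ y)) ⊕ V ⊗ y)) refl
        simplify : ∀ x U y → ι (+ 1) ✶ x ⊹ ⊟ (U ✶ ι (+ 1)) ⊹ y ≡ x ⊹ ⊟ U ⊹ y
        simplify = solveθ 3 (λ x U y → (Κ (ι (+ 1)) ⊗ x ⊕ ⊝ (U ⊗ Κ (ι (+ 1))) ⊕ y) ≜ (x ⊕ ⊝ U ⊕ y)) refl

      -- T(n - 2) is the θ²-coefficient of xθ⁻¹ = x⁻² x³ θ⁻¹, which is x⁻² modulo m;
      -- `inverse-square` expresses x⁻² through x and x².
      θ⁻¹-relation : T (n - + 2) ≡ α + v * (β - u * α) + m * c₂ (x′ ✶ x′ ✶ θ⁻¹ ✶ z)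
      θ⁻¹-relation = begin
        T (n - + 2)
          ≡⟨ c₂-θ⁻¹ x ⟨
        c₂ (x ✶ θ⁻¹)
          ≡⟨ cong (λ y → c₂ (y ✶ θ⁻¹)) cancelled ⟨
        c₂ (x′ ✶ x′ ✶ (x ✶ (x ✶ x)) ✶ θ⁻¹)
          ≡⟨ cong (λ y → c₂ (x′ ✶ x′ ✶ y ✶ θ⁻¹)) cube ⟩
        c₂ (x′ ✶ x′ ✶ (θ ⊹ ι m ✶ z) ✶ θ⁻¹)
          ≡⟨ cong c₂ (distribute (x′ ✶ x′) (ι m) z θ θ⁻¹) ⟩
        c₂ (θ ✶ θ⁻¹ ✶ (x′ ✶ x′)) + c₂ (ι m ✶ (x′ ✶ x′ ✶ θ⁻¹ ✶ z))
          ≡⟨ cong₂ _+_ (cong c₂ (trans (✶-identityˡ (x′ ✶ x′)) inverse-square)) (c₂-ι m (x′ ✶ x′ ✶ θ⁻¹ ✶ z)) ⟩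
        α + + 0 + c₂ (V ✶ x′) + m * c₂ (x′ ✶ x′ ✶ θ⁻¹ ✶ z)
          ≡⟨ cong (λ i → i + m * c₂ (x′ ✶ x′ ✶ θ⁻¹ ✶ z))
               (cong₂ _+_ (+-identityʳ α) (trans (c₂-ι v x′) (cong (v *_) (trans (+-identityʳ _) (cong (λ i → β - i) (c₂-ι u x)))))) ⟩
        α + v * (β - u * α) + m * c₂ (x′ ✶ x′ ✶ θ⁻¹ ✶ z) ∎
        where
        cancelled : x′ ✶ x′ ✶ (x ✶ (x ✶ x)) ≡ x
        cancelled = trans (pair x x′) (trans (cong (λ y → y ✶ y ✶ x) inverse) (✶-identityˡ x))
          where
          pair : ∀ x y → y ✶ y ✶ (x ✶ (x ✶ x)) ≡ (x ✶ y) ✶ (x ✶ y) ✶ x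
          pair = solveθ 2 (λ x y → (y ⊗ y ⊗ (x ⊗ (x ⊗ x))) ≜ ((x ⊗ y) ⊗ (x ⊗ y) ⊗ x)) refl
        distribute : ∀ s m z t t⁻¹ → s ✶ (t ⊹ m ✶ z) ✶ t⁻¹ ≡ t ✶ t⁻¹ ✶ s ⊹ m ✶ (s ✶ t⁻¹ ✶ z)
        distribute = solveθ 5 (λ s m z t t⁻¹ → (s ⊗ (t ⊕ m ⊗ z) ⊗ t⁻¹) ≜ (t ⊗ t⁻¹ ⊗ s ⊕ m ⊗ (s ⊗ t⁻¹ ⊗ z))) refl

      m∣uβ-vα : m ∣ u * β - v * α
      m∣uβ-vα = divides (c₂ z) (trans (sym cubic-relation) (*-comm m (c₂ z)))

      m∣T+vβ-α : m ∣ T n + v * β - α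
      m∣T+vβ-α = divides (u * c₂ z - c₂ (x ✶ z)) (isolate (T n) m (c₂ (x ✶ z)) u (c₂ z) α (v * β) quartic-relation)
        where
        isolate : ∀ τ m r u s a b → τ + m * r ≡ u * (m * s) + a - b → τ + b - a ≡ (u * s - r) * m
        isolate τ m r u s a b eq = trans (lhs τ m r a b) (trans (cong (λ i → i - m * r + b - a) eq) (rhs m r u s a b))
          where
          lhs : ∀ τ m r a b → τ + b - a ≡ τ + m * r - m * r + b - a
          lhs = solve-∀
          rhs : ∀ m r u s a b → u * (m * s) + a - b - m * r + b - a ≡ (u * s - r) * m
          rhs = solve-∀

      m∣T₂-α-v[β-uα] : m ∣ T (n - + 2) - (α + v * (β - u * α))
      m∣T₂-α-v[β-uα] = divides (c₂ (x′ ✶ x′ ✶ θ⁻¹ ✶ z))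
        (trans (cong (_- (α + v * (β - u * α))) θ⁻¹-relation) (isolate (α + v * (β - u * α)) m (c₂ (x′ ✶ x′ ✶ θ⁻¹ ✶ z))))
        where
        isolate : ∀ a m r → a + m * r - a ≡ r * m
        isolate = solve-∀

    -- T(n) ≡ α - vβ and uβ ≡ vα; multiplying the first by u eliminates β and leaves (u - v²)α.
    ∣u*T[n] : m ∣ u - v * v → m ∣ u * T n
    ∣u*T[n] u≡v² = ∣-combine (+ 1) α (∣-combine u (- v) m∣T+vβ-α m∣uβ-vα refl)
      u≡v² (identity u v α β (T n))
      where
      identity : ∀ u v α β τ → u * τ ≡ + 1 * (u * (τ + v * β - α) + - v * (u * β - v * α)) + α * (u - v * v)
      identity = solve-∀

    -- Eliminating β in the same way leaves (u + v² - u²v)α, and u²v ≡ 2u, v² ≡ u make the bracket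
    -- vanish.
    ∣u*T[n-2] : m ∣ u * v - + 2 → m ∣ u - v * v → m ∣ u * T (n - + 2)
    ∣u*T[n-2] uv≡2 u≡v² = ∣-combine (+ 1) (- α) (∣-combine u v m∣T₂-α-v[β-uα] m∣uβ-vα refl)
      (∣-combine u (+ 1) uv≡2 u≡v² refl) (identity u v α β (T (n - + 2)))
      where
      identity : ∀ u v α β σ → u * σ ≡ + 1 * (u * (σ - (α + v * (β - u * α))) + v * (u * β - v * α))
                                      + - α * (u * (u * v - + 2) + + 1 * (u - v * v))
      identity = solve-∀

  -- Primes modulo which X³ − X² − X − 1 splits

  ^-cong-∣ : ∀ {m a b} → m ∣ a - b → ∀ n → m ∣ a ^ n - b ^ n
  ^-cong-∣ d zero = divides (+ 0) refl
  ^-cong-∣ {m} {a} {b} d (suc n) =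
    ∣-combine (a ^ n) b d (^-cong-∣ d n) (identity a b (a ^ n) (b ^ n))
    where
    identity : ∀ a b x y → a * x - b * y ≡ x * (a - b) + b * (x - y)
    identity = solve-∀

  χ : ℤ → ℤ
  χ x = x * x * x - x * x - x - + 1

  ev : ℤ → ℤ[θ] → ℤ
  ev r x = c₀ x + c₁ x * r + c₂ x * (r * r)

  -- Evaluation at r respects multiplication by θ up to a multiple of χ(r), hence sends θⁿ to rⁿ
  -- modulo m.
  ev-Θ : ∀ {m r} → m ∣ χ r → ∀ n → m ∣ ev r (Θ (+ n)) - r ^ n
  ev-Θ {m} {r} d zero = divides (+ 0) (cong (_- + 1) (trivial r))
    where
    trivial : ∀ r → + 1 + + 0 * r + + 0 * (r * r) ≡ + 1
    trivial = solve-∀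
  ev-Θ {m} {r} d (suc n) = ∣-combine (- c₂ x) r d (ev-Θ {m} {r} d n)
    (trans (cong (λ y → ev r y - r * r ^ n) (trans (Θ-suc (+ n)) (θ-shift (c₀ x) (c₁ x) (c₂ x))))
      (identity (c₀ x) (c₁ x) (c₂ x) r (r ^ n)))
    where
    x = Θ (+ n)
    identity : ∀ a b c r s → c + (a + c) * r + (b + c) * (r * r) - r * s ≡
      - c * (r * r * r - r * r - r - + 1) + r * (a + b * r + c * (r * r) - s)
    identity = solve-∀

  module _ {p-1 : ℕ} (pr : Prime (suc p-1)) where

    private
      p = suc p-1

    p∤1 : ¬ + p ∣ + 1
    p∤1 d = ℕ.nonTrivial⇒≢1 ⦃ prime⇒nonTrivial pr ⦄ (ℕ.∣1⇒≡1 (∣⇒∣ᵤ d))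

    p∤unit : ∀ {x y} → + p ∣ x * y - + 1 → ¬ + p ∣ x
    p∤unit {x} {y} d p∣x = p∤1 (∣-combine y (- (+ 1)) p∣x d (identity x y))
      where
      identity : ∀ x y → + 1 ≡ y * x + - (+ 1) * (x * y - + 1)
      identity = solve-∀

    -- By Fermat the quadratic polynomial representing θᵖ⁻¹ - 1 vanishes at three distinct roots
    -- modulo p, so its coefficients vanish. They are isolated by divided differences, the first of
    -- which is `slope`.
    Θ[p-1]≡1 : ∀ {a b c} → + p ∣ χ a → + p ∣ χ b → + p ∣ χ c →
      ¬ + p ∣ a - b → ¬ + p ∣ a - c → ¬ + p ∣ b - c → One-mod (+ p) (Θ (+ p-1))
    Θ[p-1]≡1 {a} {b} {c} fa fb fc a≢b a≢c b≢c = build p∣y₀ p∣y₁ p∣y₂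
      where
      x = Θ (+ p-1)
      y₀ = c₀ x - + 1
      y₁ = c₁ x
      y₂ = c₂ x
      root : ∀ {r} → + p ∣ χ r → + p ∣ y₀ + y₁ * r + y₂ * (r * r)
      root {r} fr = ∣-combine (+ 1) (+ 1) (ev-Θ fr p-1) (fermat′ pr {r} p∤r) (identity (c₀ x) y₁ y₂ r (r ^ p-1))
        where
        identity : ∀ a b c r s → a - + 1 + b * r + c * (r * r) ≡ + 1 * (a + b * r + c * (r * r) - s) + + 1 * (s - + 1)
        identity = solve-∀
        factor : ∀ r → r * (r * r - r - + 1) - + 1 ≡ r * r * r - r * r - r - + 1
        factor = solve-∀
        -- Fermat needs r invertible: a root of χ satisfies r(r² - r - 1) ≡ 1.
        p∤r : ¬ + p ∣ r
        p∤r = p∤unit {r} {r * r - r - + 1} (subst (+ p ∣_) (sym (factor r)) fr)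
      slope : ∀ {r s} → + p ∣ χ r → + p ∣ χ s → ¬ + p ∣ r - s → + p ∣ y₁ + y₂ * (r + s)
      slope {r} {s} fr fs r≢s = cancel pr r≢s
        (∣-combine (+ 1) (- (+ 1)) (root {r} fr) (root {s} fs) (identity y₀ y₁ y₂ r s))
        where
        identity : ∀ x y z r s → (r - s) * (y + z * (r + s)) ≡ + 1 * (x + y * r + z * (r * r)) + - (+ 1) * (x + y * s + z * (s * s))
        identity = solve-∀
      p∣y₂ : + p ∣ y₂
      p∣y₂ = cancel pr b≢c (∣-combine (+ 1) (- (+ 1)) (slope {a} {b} fa fb a≢b) (slope {a} {c} fa fc a≢c) (identity y₁ y₂ a b c))
        where
        identity : ∀ y z a b c → (b - c) * z ≡ + 1 * (y + z * (a + b)) + - (+ 1) * (y + z * (a + c))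
        identity = solve-∀
      p∣y₁ : + p ∣ y₁
      p∣y₁ = ∣-combine (+ 1) (- (a + b)) (slope {a} {b} fa fb a≢b) p∣y₂ (identity y₁ y₂ a b)
        where
        identity : ∀ y z a b → y ≡ + 1 * (y + z * (a + b)) + - (a + b) * z
        identity = solve-∀
      p∣y₀ : + p ∣ y₀
      p∣y₀ = ∣-combine (+ 1) (- (+ 1)) (root {a} fa) (∣-combine a (a * a) p∣y₁ p∣y₂ refl) (identity y₀ y₁ y₂ a)
        where
        identity : ∀ x y z a → x ≡ + 1 * (x + y * a + z * (a * a)) + - (+ 1) * (a * y + a * a * z)
        identity = solve-∀
      build : + p ∣ y₀ → + p ∣ y₁ → + p ∣ y₂ → One-mod (+ p) x
      build (divides q₀ e₀) (divides q₁ e₁) (divides q₂ e₂) = ⟨ q₀ , q₁ , q₂ ⟩ , ≡-coordinates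
        (trans (shift (c₀ x)) (trans (cong (λ i → + 1 + i) e₀) (scalar₀ (+ p) q₀ q₁ q₂)))
        (trans e₁ (scalar₁ (+ p) q₀ q₁ q₂))
        (trans e₂ (scalar₂ (+ p) q₀ q₁ q₂))
        where
        shift : ∀ a → a ≡ + 1 + (a - + 1)
        shift = solve-∀
        scalar₀ : ∀ m a b c → + 1 + a * m ≡ + 1 + (m * a + (+ 0 * c + + 0 * b + + 0 * c))
        scalar₀ = solve-∀
        scalar₁ : ∀ m a b c → b * m ≡ + 0 + (m * b + + 0 * a + (+ 0 * c + + 0 * b + (+ 0 * c + + 0 * c)))
        scalar₁ = solve-∀
        scalar₂ : ∀ m a b c → c * m ≡ + 0 + (m * c + (+ 0 * b + + 0 * a) + (+ 0 * c + + 0 * b + (+ 0 * c + + 0 * c)))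
        scalar₂ = solve-∀

  -- Primes p = 3q + 2 dividing a value of h

  module _ {q : ℕ} (pr : Prime (2 ℕ.+ q ℕ.* 3)) where

    private
      p = 2 ℕ.+ q ℕ.* 3

    inverse-mod : ∀ {a} → ¬ + p ∣ a → ∃[ b ] + p ∣ a * b - + 1
    inverse-mod {a} p∤a = a ^ (q ℕ.* 3) , fermat′ pr p∤a

    -- p - 1 = 3q + 1, so equal cubes have equal 3q-th powers, and x, y are the inverses of these
    -- modulo p.
    cube-injective : ∀ {x y} → ¬ + p ∣ x → ¬ + p ∣ y → + p ∣ x * x * x - y * y * y → + p ∣ x - y
    cube-injective {x} {y} p∤x p∤y d = cancel pr {x ^ (q ℕ.* 3)}
      (p∤unit pr {x ^ (q ℕ.* 3)} {x}
        (subst (+ p ∣_) (cong (_- + 1) (*-comm x (x ^ (q ℕ.* 3)))) (fermat′ pr p∤x)))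
      (∣-combine (+ 1) (- y) (∣m∣n⇒∣m-n (fermat′ pr p∤x) (fermat′ pr p∤y))
        (subst₂ (λ a b → + p ∣ a - b) (power x) (power y) (^-cong-∣ {a = x * x * x} {b = y * y * y} d q))
        (identity x y (x ^ (q ℕ.* 3)) (y ^ (q ℕ.* 3))))
      where
      identity : ∀ x y X Y → X * (x - y) ≡ + 1 * (x * X - + 1 - (y * Y - + 1)) + - y * (X - Y)
      identity = solve-∀
      power : ∀ x → (x * x * x) ^ q ≡ x ^ (q ℕ.* 3)
      power x = begin
        (x * x * x) ^ q ≡⟨ cong (_^ q) (assoc x) ⟩
        (x ^ 3) ^ q     ≡⟨ ^-assocʳ x 3 q ⟩
        x ^ (3 ℕ.* q)   ≡⟨ cong (x ^_) (ℕ.*-comm 3 q) ⟩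
        x ^ (q ℕ.* 3)   ∎
        where
        assoc : ∀ x → x * x * x ≡ x * (x * (x * + 1))
        assoc = solve-∀

    module _ (p∤2 : ¬ + p ∣ + 2) (p∤3 : ¬ + p ∣ + 3) where

      private
        p∤6 : ¬ + p ∣ + 6
        p∤6 = ∤-* pr {+ 2} {+ 3} p∤2 p∤3

        p∤12 : ¬ + p ∣ + 12
        p∤12 = ∤-* pr {+ 2} {+ 6} p∤2 p∤6

      -- (s − g)³ − (2g)³ = (s² + 3g²)(s − 3g), so a zero of s² + 3g² would give s = 3g and then 12g² = 0.
      -3-nonsquare : ∀ {s g} → ¬ + p ∣ g → ¬ + p ∣ s * s + + 3 * (g * g)
      -3-nonsquare {s} {g} p∤g d = ∤-* pr {+ 12} {g * g} p∤12 (∤-* pr {g} {g} p∤g p∤g)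
        (∣-combine (+ 1) (- (s + + 3 * g)) d
          (subst (+ p ∣_) (linear s g) (cube-injective {s - g} {+ 2 * g} p∤s-g (∤-* pr {+ 2} {g} p∤2 p∤g)
            (∣-multiple (s - + 3 * g) d (cubes s g))))
          (square s g))
        where
        square : ∀ s g → + 12 * (g * g) ≡ + 1 * (s * s + + 3 * (g * g)) + - (s + + 3 * g) * (s - + 3 * g)
        square = solve-∀
        linear : ∀ s g → s - g - + 2 * g ≡ s - + 3 * g
        linear = solve-∀
        cubes : ∀ s g → (s - g) * (s - g) * (s - g) - + 2 * g * (+ 2 * g) * (+ 2 * g) ≡ (s - + 3 * g) * (s * s + + 3 * (g * g))
        cubes = solve-∀
        four : ∀ s g → + 2 * + 2 * (g * g) ≡ + 1 * (s * s + + 3 * (g * g)) + - (s + g) * (s - g)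
        four = solve-∀
        p∤s-g : ¬ + p ∣ s - g
        p∤s-g p∣s-g = ∤-* pr {+ 2 * + 2} {g * g} (∤-* pr {+ 2} {+ 2} p∤2 p∤2) (∤-* pr {g} {g} p∤g p∤g)
          (∣-combine (+ 1) (- (s + g)) d p∣s-g (four s g))

      module _ (p∤11 : ¬ + p ∣ + 11) (p∤19 : ¬ + p ∣ + 19) (d : ℤ)
               (h : + p ∣ d * (d * d - + 4) * (d * (d * d - + 4)) + + 44) where

        private
          -- `g` is a square root of -44, the discriminant of χ, modulo p. In z = 3γ - 1 the
          -- equation 27 χ(γ) = 0 reads z(z² - 12) = 38, and `W` is z² - 12 expressed by the
          -- difference d of the other two roots, since z² = 16 - 3d².
          g W : ℤ
          g = d * (d * d - + 4)
          W = + 4 - + 3 * (d * d)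

          p∤g : ¬ + p ∣ g
          p∤g p∣g = ∤-* pr {+ 4} {+ 11} (∤-* pr {+ 2} {+ 2} p∤2 p∤2) p∤11
            (∣-combine (+ 1) (- g) h p∣g (identity g))
            where
            identity : ∀ g → + 44 ≡ + 1 * (g * g + + 44) + - g * g
            identity = solve-∀

          p∤d : ¬ + p ∣ d
          p∤d p∣d = p∤g (∣m⇒∣m*n (d * d - + 4) p∣d)

          p∤d²-4 : ¬ + p ∣ d * d - + 4
          p∤d²-4 p∣d²-4 = p∤g (∣n⇒∣m*n d p∣d²-4)

          -- 27 h(d) = 4·19² − W²(W + 12), so only 2 and 19 can divide both h(d) and W.
          p∤W : ¬ + p ∣ W
          p∤W p∣W = ∤-* pr {+ 19} p∤19 (∤-* pr {+ 19} {+ 4} p∤19 (∤-* pr {+ 2} {+ 2} p∤2 p∤2))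
            (∣-combine (+ 27) (W * (W + + 12)) h p∣W (identity d))
            where
            identity : ∀ d → let W = + 4 - + 3 * (d * d) ; g = d * (d * d - + 4) in
              + 19 * (+ 19 * + 4) ≡ + 27 * (g * g + + 44) + W * (W + + 12) * W
            identity = solve-∀

        -- Multiplied by W², the claim compares 38² = 4·19² with W²(W + 12); their difference is 27
        -- h(d).
        zW≡38⇒z²≡W+12 : ∀ z → + p ∣ z * W - + 38 → + p ∣ z * z - W - + 12
        zW≡38⇒z²≡W+12 z zW≡38 = cancel pr {W * W} (∤-* pr {W} {W} p∤W p∤W)
          (∣-combine (z * W + + 38) (+ 27) zW≡38 h (identity d z))
          where
          identity : ∀ d z → let W = + 4 - + 3 * (d * d) ; g = d * (d * d - + 4) in
            W * W * (z * z - W - + 12) ≡ (z * W + + 38) * (z * W - + 38) + + 27 * (g * g + + 44)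
          identity = solve-∀

        -- z = 3γ − 1, where γ is the root of χ other than the two with difference d.
        ∃z : ∃[ z ] (+ p ∣ z * W - + 38) × (+ p ∣ z * z - W - + 12)
        ∃z = z , zW≡38 , zW≡38⇒z²≡W+12 z zW≡38
          where
          i z : ℤ
          i = proj₁ (inverse-mod {W} p∤W)
          z = + 38 * i
          scale : ∀ W i → + 38 * i * W - + 38 ≡ + 38 * (W * i - + 1)
          scale = solve-∀
          zW≡38 : + p ∣ z * W - + 38
          zW≡38 = ∣-multiple (+ 38) (proj₂ (inverse-mod {W} p∤W)) (scale W i)

        -- The cubic in t is 216 χ(t / 6); this scaling makes the three roots integral in d and z.
        root : ∀ t → + p ∣ t * t * t - + 6 * (t * t) - + 36 * t - + 216 → ∃[ r ] (+ p ∣ + 6 * r - t) × (+ p ∣ χ r)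
        root t ft = r , 6r≡t , cancel pr {+ 216} (∤-* pr {+ 6} {+ 36} p∤6 (∤-* pr {+ 6} {+ 6} p∤6 p∤6))
          (∣-combine (+ 1) (+ 36 * (r * r) + + 6 * r * t + t * t - + 6 * (+ 6 * r + t) - + 36) ft 6r≡t (identity r t))
          where
          i r : ℤ
          i = proj₁ (inverse-mod {+ 6} p∤6)
          r = i * t
          scale : ∀ t i → + 6 * (i * t) - t ≡ t * (+ 6 * i - + 1)
          scale = solve-∀
          6r≡t : + p ∣ + 6 * r - t
          6r≡t = ∣-multiple t (proj₂ (inverse-mod {+ 6} p∤6)) (scale t i)
          identity : ∀ r t → + 216 * (r * r * r - r * r - r - + 1) ≡
            + 1 * (t * t * t - + 6 * (t * t) - + 36 * t - + 216) +
            (+ 36 * (r * r) + + 6 * r * t + t * t - + 6 * (+ 6 * r + t) - + 36) * (+ 6 * r - t)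
          identity = solve-∀

        apart : ∀ {r s t w} → + p ∣ + 6 * r - t → + p ∣ + 6 * s - w → ¬ + p ∣ t - w → ¬ + p ∣ r - s
        apart {r} {s} {t} {w} r≡t s≡w t≢w r≡s = t≢w (∣-combine (+ 6) (+ 1) r≡s (∣m∣n⇒∣m-n s≡w r≡t) (identity r s t w))
          where
          identity : ∀ r s t w → t - w ≡ + 6 * (r - s) + + 1 * (+ 6 * s - w - (+ 6 * r - t))
          identity = solve-∀

        -- The third root satisfies 6γ = 2 + 2z; the other two have sum 1 - γ and difference d, so
        -- six times them is 2 - z ± 3d. They are distinct because d is a unit and d² - z² ≡ 4(d² -
        -- 4) is one too.
        Θ-period : One-mod (+ p) (Θ (+ suc (q ℕ.* 3)))
        Θ-period = Θ[p-1]≡1 pr {a} {b} {c} (proj₂ (proj₂ root-a)) (proj₂ (proj₂ root-b)) (proj₂ (proj₂ root-c))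
          (apart {a} {b} (proj₁ (proj₂ root-a)) (proj₁ (proj₂ root-b)) (λ p∣ → ∤-* pr {+ 6} {d} p∤6 p∤d
            (subst (+ p ∣_) (a-b d z) p∣)))
          (apart {a} {c} (proj₁ (proj₂ root-a)) (proj₁ (proj₂ root-c)) (λ p∣ → ∤-* pr {+ 3} {d - z} p∤3 p∤d-z
            (subst (+ p ∣_) (a-c d z) p∣)))
          (apart {b} {c} (proj₁ (proj₂ root-b)) (proj₁ (proj₂ root-c)) (λ p∣ → ∤-* pr {+ 3} {d + z} p∤3 p∤d+z
            (subst (+ p ∣_) (c-b d z) (∣m⇒∣-m p∣))))
          where
          z : ℤ
          z = proj₁ ∃z
          zW≡38 : + p ∣ z * W - + 38
          zW≡38 = proj₁ (proj₂ ∃z)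
          z²≡W+12 : + p ∣ z * z - W - + 12
          z²≡W+12 = proj₂ (proj₂ ∃z)
          identity-a : ∀ d z → let W = + 4 - + 3 * (d * d) ; t = + 2 - z + + 3 * d in
            t * t * t - + 6 * (t * t) - + 36 * t - + 216 ≡ (+ 9 * d - z) * (z * z - W - + 12) + + 8 * (z * W - + 38)
          identity-a = solve-∀
          identity-b : ∀ d z → let W = + 4 - + 3 * (d * d) ; t = + 2 - z - + 3 * d in
            t * t * t - + 6 * (t * t) - + 36 * t - + 216 ≡ (- (+ 9 * d) - z) * (z * z - W - + 12) + + 8 * (z * W - + 38)
          identity-b = solve-∀
          identity-c : ∀ d z → let W = + 4 - + 3 * (d * d) ; t = + 2 + + 2 * z in
            t * t * t - + 6 * (t * t) - + 36 * t - + 216 ≡ + 8 * z * (z * z - W - + 12) + + 8 * (z * W - + 38)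
          identity-c = solve-∀
          root-a : ∃[ r ] (+ p ∣ + 6 * r - (+ 2 - z + + 3 * d)) × (+ p ∣ χ r)
          root-a = root (+ 2 - z + + 3 * d) (∣-combine (+ 9 * d - z) (+ 8) z²≡W+12 zW≡38 (identity-a d z))
          root-b : ∃[ r ] (+ p ∣ + 6 * r - (+ 2 - z - + 3 * d)) × (+ p ∣ χ r)
          root-b = root (+ 2 - z - + 3 * d) (∣-combine (- (+ 9 * d) - z) (+ 8) z²≡W+12 zW≡38 (identity-b d z))
          root-c : ∃[ r ] (+ p ∣ + 6 * r - (+ 2 + + 2 * z)) × (+ p ∣ χ r)
          root-c = root (+ 2 + + 2 * z) (∣-combine (+ 8 * z) (+ 8) z²≡W+12 zW≡38 (identity-c d z))
          a b c : ℤ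
          a = proj₁ root-a
          b = proj₁ root-b
          c = proj₁ root-c
          a-b : ∀ d z → + 2 - z + + 3 * d - (+ 2 - z - + 3 * d) ≡ + 6 * d
          a-b = solve-∀
          a-c : ∀ d z → + 2 - z + + 3 * d - (+ 2 + + 2 * z) ≡ + 3 * (d - z)
          a-c = solve-∀
          c-b : ∀ d z → - (+ 2 - z - + 3 * d - (+ 2 + + 2 * z)) ≡ + 3 * (d + z)
          c-b = solve-∀
          difference : ∀ d z → let W = + 4 - + 3 * (d * d) in + 2 * + 2 * (d * d - + 4) ≡ + 1 * ((d - z) * (d + z)) + + 1 * (z * z - W - + 12)
          difference = solve-∀
          p∤d²-z² : ¬ + p ∣ (d - z) * (d + z)
          p∤d²-z² p∣ = ∤-* pr {+ 2 * + 2} {d * d - + 4} (∤-* pr {+ 2} {+ 2} p∤2 p∤2) p∤d²-4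
            (∣-combine (+ 1) (+ 1) p∣ z²≡W+12 (difference d z))
          p∤d-z : ¬ + p ∣ d - z
          p∤d-z p∣ = p∤d²-z² (∣m⇒∣m*n (d + z) p∣)
          p∤d+z : ¬ + p ∣ d + z
          p∤d+z p∣ = p∤d²-z² (∣n⇒∣m*n (d - z) p∣)

        -- 4(w² − 7w + 4) = (2w − 7)² − 33, and g² ≡ −44 turns 132 = 3·44 into −3g².
        spurious-factor : ∀ w → ¬ + p ∣ w * w - + 7 * w + + 4
        spurious-factor w p∣ = -3-nonsquare {+ 2 * (+ 2 * w - + 7)} {g} p∤g
          (∣-combine (+ 16) (+ 3) p∣ h (identity w g))
          where
          identity : ∀ w g → + 2 * (+ 2 * w - + 7) * (+ 2 * (+ 2 * w - + 7)) + + 3 * (g * g) ≡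
            + 16 * (w * w - + 7 * w + + 4) + + 3 * (g * g + + 44)
          identity = solve-∀

        -- Here x³ = θ³ⁿ = θ · θ^(3n - 1), and the last factor is 1 modulo pᵏ⁺¹, so the cube-root
        -- relations apply; u is then cancelled as a unit.
        T-zeros : ∀ k n t → + 3 * n - + 1 ≡ t * (+ (p ℕ.^ k) * + suc (q ℕ.* 3)) →
          (+ (p ℕ.^ suc k) ∣ T n) × (+ (p ℕ.^ suc k) ∣ T (n - + 2))
        T-zeros k n t eq = cancel-^ pr (suc k) p∤u (∣u*T[n] n (θ ✶ z) cube u≡v²)
                         , cancel-^ pr (suc k) p∤u (∣u*T[n-2] n (θ ✶ z) cube uv≡2 u≡v²)
          where
          M L : ℤ
          M = + (p ℕ.^ suc k)
          L = + (p ℕ.^ k) * + suc (q ℕ.* 3)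
          one : One-mod M (Θ (t * L))
          one = Θ-one-mod-multiples {M} {L} (Θ-one-mod-lift p {+ suc (q ℕ.* 3)} Θ-period k) t
          x z : ℤ[θ]
          x = Θ n
          z = proj₁ one
          u v : ℤ
          u = tr x
          v = e₂ x
          cube : x ✶ (x ✶ x) ≡ θ ⊹ ι M ✶ (θ ✶ z)
          cube = begin
            x ✶ (x ✶ x)               ≡⟨ trans (Θ-+ n (n + n)) (cong (x ✶_) (Θ-+ n n)) ⟨
            Θ (n + (n + n))           ≡⟨ cong Θ (trans (triple n) (cong (λ i → + 1 + i) eq)) ⟩
            Θ (+ 1 + t * L)           ≡⟨ Θ-suc (t * L) ⟩
            θ ✶ Θ (t * L)             ≡⟨ cong (θ ✶_) (proj₂ one) ⟩
            θ ✶ (ι (+ 1) ⊹ ι M ✶ z)   ≡⟨ distribute θ (ι M) z ⟩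
            θ ⊹ ι M ✶ (θ ✶ z)         ∎
            where
            triple : ∀ n → n + (n + n) ≡ + 1 + (+ 3 * n - + 1)
            triple = solve-∀
            distribute : ∀ t m z → t ✶ (ι (+ 1) ⊹ m ✶ z) ≡ t ⊹ m ✶ (t ✶ z)
            distribute = solveθ 3 (λ t m z → (t ⊗ (Κ (ι (+ 1)) ⊕ m ⊗ z)) ≜ (t ⊕ m ⊗ (t ⊗ z))) refl
          p∣M : + p ∣ M
          p∣M = divides (+ (p ℕ.^ k)) (trans (pos-* p (p ℕ.^ k)) (*-comm (+ p) (+ (p ℕ.^ k))))
          -- With w = uv, multiplying u³ ≡ 3w - 2 by v³ ≡ 3w - 4 gives w³ ≡ (3w - 2)(3w - 4). The
          -- quadratic factor is a unit modulo p, so it can be cancelled modulo the full power.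
          uv≡2 : M ∣ u * v - + 2
          uv≡2 = cancel-^ pr (suc k) {u * v * (u * v) - + 7 * (u * v) + + 4} (spurious-factor (u * v))
            (∣-combine (v * v * v) (+ 3 * (u * v) - + 2) (newton-u n (θ ✶ z) cube) (newton-v n (θ ✶ z) cube) (identity u v))
            where
            identity : ∀ u v → (u * v * (u * v) - + 7 * (u * v) + + 4) * (u * v - + 2) ≡
              v * v * v * (u * u * u - + 3 * u * v + + 2) + (+ 3 * (u * v) - + 2) * (v * v * v - + 3 * u * v + + 4)
            identity = solve-∀
          p∤v : ¬ + p ∣ v
          p∤v p∣v = p∤2 (∣-combine u (- (+ 1)) p∣v (∣-trans p∣M uv≡2) (identity u v))
            where
            identity : ∀ u v → + 2 ≡ u * v + - (+ 1) * (u * v - + 2)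
            identity = solve-∀
          p∤u : ¬ + p ∣ u
          p∤u p∣u = p∤2 (∣-combine v (- (+ 1)) p∣u (∣-trans p∣M uv≡2) (identity u v))
            where
            identity : ∀ u v → + 2 ≡ v * u + - (+ 1) * (u * v - + 2)
            identity = solve-∀
          -- `newton-v` with uv ≡ 2 gives v³ ≡ 2 ≡ uv, and v is cancelled.
          u≡v² : M ∣ u - v * v
          u≡v² = cancel-^ pr (suc k) {v} p∤v (∣-combine (- (+ 2)) (- (+ 1)) uv≡2 (newton-v n (θ ✶ z) cube) (identity u v))
            where
            identity : ∀ u v → v * (u - v * v) ≡ - (+ 2) * (u * v - + 2) + - (+ 1) * (v * v * v - + 3 * u * v + + 4)
            identity = solve-∀

  -- Infinitely many such primes

  prime-∣-prime : ∀ {p q} → Prime p → Prime q → p ℕ.∣ q → p ≡ q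
  prime-∣-prime pp pq p∣q with prime⇒irreducible pq p∣q
  ... | inj₁ p≡1 = contradiction p≡1 (ℕ.nonTrivial⇒≢1 ⦃ prime⇒nonTrivial pp ⦄)
  ... | inj₂ p≡q = p≡q

  -- A first factor of residue 0 would make the product 0 modulo 3, and one of residue 1 passes the
  -- residue 2 on to the remaining product.
  prime-factor-2-mod-3 : ∀ {ps} → All Prime ps → product ps % 3 ≡ 2 → ∃[ p ] Prime p × p % 3 ≡ 2 × p ℕ.∣ product ps
  prime-factor-2-mod-3 [] ()
  prime-factor-2-mod-3 {p ∷ ps} (pr ∷ prs) eq = by-residue (p % 3) refl (m%n<n p 3)
    where
    residues : (p % 3 ℕ.* (product ps % 3)) % 3 ≡ 2
    residues = trans (sym (%-distribˡ-* p (product ps) 3)) eq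
    tail : ∀ r → r ≡ p % 3 → (r ℕ.* (product ps % 3)) % 3 ≡ 2
    tail r r≡ = subst (λ r → (r ℕ.* (product ps % 3)) % 3 ≡ 2) (sym r≡) residues
    by-residue : ∀ r → r ≡ p % 3 → r ℕ.< 3 → ∃[ p′ ] Prime p′ × p′ % 3 ≡ 2 × p′ ℕ.∣ p ℕ.* product ps
    by-residue 0 r≡ _ = contradiction (tail 0 r≡) λ ()
    by-residue 1 r≡ _ with prime-factor-2-mod-3 prs (trans (%-idem (product ps)) (tail 1 r≡))
      where
      %-idem : ∀ m → m % 3 ≡ (1 ℕ.* (m % 3)) % 3
      %-idem m = trans (cong (_% 3) (sym (ℕ.*-identityˡ m))) (%-distribˡ-* 1 m 3)
    ... | p′ , pr′ , p′%3≡2 , p′∣ps = p′ , pr′ , p′%3≡2 , ℕ.∣n⇒∣m*n p p′∣ps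
    by-residue 2 r≡ _ = p , pr , sym r≡ , ℕ.m∣m*n (product ps)
    by-residue (suc (suc (suc r))) _ (ℕ.s≤s (ℕ.s≤s (ℕ.s≤s ())))

  module _ (r : ℕ) where

    without : ℕ → ℕ
    without n with r ℕ.∣? n
    ... | yes _ = 1
    ... | no  _ = n

    -- The factorial with multiples of r replaced by 1: for prime r it stays prime to r, yet is
    -- divisible by every other prime up to n.
    factorial-without : ℕ → ℕ
    factorial-without zero    = 1
    factorial-without (suc n) = without (suc n) ℕ.* factorial-without n

    ∣factorial-without : ∀ n {i} → i ℕ.≤ n → ¬ r ℕ.∣ i → 0 ℕ.< i → i ℕ.∣ factorial-without n
    ∣factorial-without zero    i≤0 _   0<i = contradiction 0<i (ℕ.≤⇒≯ i≤0)
    ∣factorial-without (suc n) {i} i≤n r∤i 0<i with ℕ.m≤n⇒m<n∨m≡n i≤n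
    ... | inj₁ (ℕ.s≤s i≤n′) = ℕ.∣n⇒∣m*n (without (suc n)) (∣factorial-without n i≤n′ r∤i 0<i)
    ... | inj₂ refl with r ℕ.∣? suc n
    ...   | yes r∣i = contradiction r∣i r∤i
    ...   | no  _   = ℕ.m∣m*n (factorial-without n)

    ∤factorial-without : Prime r → ∀ n → ¬ + r ∣ + factorial-without n
    ∤factorial-without pr zero d = ℕ.nonTrivial⇒≢1 ⦃ prime⇒nonTrivial pr ⦄ (ℕ.∣1⇒≡1 (∣⇒∣ᵤ d))
    ∤factorial-without pr (suc n) d = ∤-* pr {+ without (suc n)} ∤without (∤factorial-without pr n)
      (subst (+ r ∣_) (pos-* (without (suc n)) (factorial-without n)) d)
      where
      ∤without : ¬ + r ∣ + without (suc n)
      ∤without d with r ℕ.∣? suc n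
      ... | yes _   = ℕ.nonTrivial⇒≢1 ⦃ prime⇒nonTrivial pr ⦄ (ℕ.∣1⇒≡1 (∣⇒∣ᵤ d))
      ... | no  r∤n = r∤n (∣⇒∣ᵤ d)

  -- h(X) = (X(X² − 4))² + 44 is the polynomial whose roots are the differences of the roots of χ.
  record Splitting (p : ℕ) : Set where
    field
      prime : Prime p
      p%3≡2 : p % 3 ≡ 2
      p≢2   : p ≢ 2
      p≢11  : p ≢ 11
      d     : ℤ
      p∣h   : + p ∣ d * (d * d - + 4) * (d * (d * d - + 4)) + + 44

  abs-square : ∀ i → + (abs i ℕ.* abs i) ≡ i * i
  abs-square i = trans (pos-* (abs i) (abs i)) (helper i)
    where
    helper : ∀ i → + abs i * + abs i ≡ i * i
    helper (+ n)    = refl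
    helper -[1+ n ] = refl

  ∣-abs-square : ∀ {m} c n → m ℕ.∣ 11 ℕ.+ c ℕ.* (abs n ℕ.* abs n) → + m ∣ + 11 + + c * (n * n)
  ∣-abs-square {m} c n d = subst (+ m ∣_)
    (trans (pos-+ 11 (c ℕ.* (abs n ℕ.* abs n)))
      (cong (λ i → + 11 + i) (trans (pos-* c (abs n ℕ.* abs n)) (cong (λ i → + c * i) (abs-square n)))))
    (∣ᵤ⇒∣ d)

  11+-factor : ∀ m → 3 ℕ.∣ m → ∃[ p ] Prime p × p % 3 ≡ 2 × p ℕ.∣ 11 ℕ.+ m
  11+-factor m (ℕ.divides c refl) = subst (λ k → ∃[ p ] Prime p × p % 3 ≡ 2 × p ℕ.∣ k)
    (sym (PrimeFactorisation.isFactorisation factorisation))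
    (prime-factor-2-mod-3 (PrimeFactorisation.factorsPrime factorisation)
      (trans (cong (_% 3) (sym (PrimeFactorisation.isFactorisation factorisation))) ([m+kn]%n≡m%n 11 c 3)))
    where
    factorisation : PrimeFactorisation (11 ℕ.+ c ℕ.* 3)
    factorisation = factorise (11 ℕ.+ c ℕ.* 3)

  prime-11 : Prime 11
  prime-11 = toWitness {a? = prime? 11} _

  -- p = 2 is impossible since 16n² + 11 is odd, and p = 11 would force 11 to divide n = y(y² - 1).
  splitting : ∀ {p} y → Prime p → p % 3 ≡ 2 → ¬ + 11 ∣ y → ¬ + 11 ∣ y * y - + 1 →
    (let n = y * (y * y - + 1)) → + p ∣ + 11 + + 16 * (n * n) → Splitting p
  splitting {p} y pr p%3≡2 11∤y 11∤y²-1 p∣16n²+11 = record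
    { prime = pr ; p%3≡2 = p%3≡2 ; p≢2 = p≢2 ; p≢11 = p≢11 ; d = + 2 * y
    ; p∣h = ∣-multiple (+ 4) p∣16n²+11 (identity y) }
    where
    n : ℤ
    n = y * (y * y - + 1)
    identity : ∀ y → let n = y * (y * y - + 1) ; d = + 2 * y in
      d * (d * d - + 4) * (d * (d * d - + 4)) + + 44 ≡ + 4 * (+ 11 + + 16 * (n * n))
    identity = solve-∀
    p≢2 : p ≢ 2
    p≢2 refl = contradiction
      (∣⇒∣ᵤ {+ 2} {+ 11} (∣m+n∣n⇒∣m {+ 2} {+ 11} {+ 16 * (n * n)} p∣16n²+11
        (∣m⇒∣m*n {+ 2} {+ 16} (n * n) (divides (+ 8) refl))))
      (toWitnessFalse {a? = 2 ℕ.∣? 11} _)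
    p≢11 : p ≢ 11
    p≢11 refl = ∤-* prime-11 {+ 16} {n * n} 11∤16 (∤-* prime-11 {n} {n} 11∤n 11∤n)
      (∣m+n∣m⇒∣n {+ 11} {+ 11} {+ 16 * (n * n)} p∣16n²+11 ∣-refl)
      where
      11∤16 : ¬ + 11 ∣ + 16
      11∤16 d = toWitnessFalse {a? = 11 ℕ.∣? 16} _ (∣⇒∣ᵤ d)
      11∤n : ¬ + 11 ∣ n
      11∤n = ∤-* prime-11 {y} {y * y - + 1} 11∤y 11∤y²-1

  -- As 3 ∣ n, the number 11 + 16n² is 2 modulo 3 and has a prime factor of that residue. If this
  -- factor divided y, it would divide 11.
  splitting-factor : ∀ y → + 3 ∣ y → ¬ + 11 ∣ y → ¬ + 11 ∣ y * y - + 1 → ∃[ p ] Splitting p × (p ≢ 11 → ¬ + p ∣ y)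
  splitting-factor y 3∣y 11∤y 11∤y²-1 = check (11+-factor (16 ℕ.* (abs n ℕ.* abs n)) 3∣16n²)
    where
    n : ℤ
    n = y * (y * y - + 1)
    ∣n : ∀ {m} → m ∣ y → m ∣ n
    ∣n {m} = ∣m⇒∣m*n {m} {y} (y * y - + 1)
    3∣16n² : 3 ℕ.∣ 16 ℕ.* (abs n ℕ.* abs n)
    3∣16n² = ℕ.∣n⇒∣m*n 16 (ℕ.∣m⇒∣m*n {3} {abs n} (abs n) (∣⇒∣ᵤ {+ 3} {n} (∣n {+ 3} 3∣y)))
    check : (∃[ p ] Prime p × p % 3 ≡ 2 × p ℕ.∣ 11 ℕ.+ 16 ℕ.* (abs n ℕ.* abs n)) → ∃[ p ] Splitting p × (p ≢ 11 → ¬ + p ∣ y)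
    check (p , pr , p%3≡2 , p∣K) = p , splitting y pr p%3≡2 11∤y 11∤y²-1 p∣16n²+11 , p∤y
      where
      p∣16n²+11 : + p ∣ + 11 + + 16 * (n * n)
      p∣16n²+11 = ∣-abs-square 16 n p∣K
      p∤y : p ≢ 11 → ¬ + p ∣ y
      p∤y p≢11 p∣y = p≢11 (prime-∣-prime pr prime-11 (∣⇒∣ᵤ {+ p} {+ 11}
        (∣m+n∣n⇒∣m {+ p} {+ 11} {+ 16 * (n * n)} p∣16n²+11 (∣n⇒∣m*n {+ p} (+ 16) {n * n} (∣m⇒∣m*n {+ p} {n} n (∣n {+ p} p∣y))))))

  -- By Fermat y = 2u⁵ has y² ≡ 4 modulo 11, so that 11 divides neither y nor y² − 1.
  module _ (u : ℤ) (11∤u : ¬ + 11 ∣ u) where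

    private
      v y : ℤ
      v = u ^ 5
      y = + 2 * v

    11∤y²-1 : ¬ + 11 ∣ y * y - + 1
    11∤y²-1 d = toWitnessFalse {a? = 11 ℕ.∣? 3} _ (∣⇒∣ᵤ {+ 11} {+ 3} (∣-combine (+ 1) (- (+ 4)) d v²≡1 (identity v)))
      where
      v²≡1 : + 11 ∣ v * v - + 1
      v²≡1 = subst (λ i → + 11 ∣ i - + 1) (^-homo-* u 5 5) (fermat′ prime-11 11∤u)
      identity : ∀ v → + 3 ≡ + 1 * (+ 2 * v * (+ 2 * v) - + 1) + - (+ 4) * (v * v - + 1)
      identity = solve-∀

    11∤y : ¬ + 11 ∣ y
    11∤y = ∤-* prime-11 {+ 2} {v} (toWitnessFalse {a? = 11 ℕ.∣? 2} _ ∘ ∣⇒∣ᵤ) (∤-^ 5)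
      where
      ∤-^ : ∀ k → ¬ + 11 ∣ u ^ k
      ∤-^ zero    d = toWitnessFalse {a? = 11 ℕ.∣? 1} _ (∣⇒∣ᵤ d)
      ∤-^ (suc k) = ∤-* prime-11 {u} {u ^ k} 11∤u (∤-^ k)

  infinitely-many-splitting : Infinite Splitting
  infinitely-many-splitting N = beyond (splitting-factor (+ 2 * (+ M) ^ 5) (M∣y (∣ᵤ⇒∣ 3∣M)) (11∤y (+ M) 11∤M) (11∤y²-1 (+ M) 11∤M))
    where
    M : ℕ
    -- The bound 3 + N ensures 3 ∣ M even for small N.
    M = factorial-without 11 (3 ℕ.+ N)
    3∣M : 3 ℕ.∣ M
    3∣M = ∣factorial-without 11 (3 ℕ.+ N) (ℕ.m≤m+n 3 N) (toWitnessFalse {a? = 11 ℕ.∣? 3} _) (ℕ.s≤s ℕ.z≤n)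
    11∤M : ¬ + 11 ∣ + M
    11∤M = ∤factorial-without 11 prime-11 (3 ℕ.+ N)
    M∣y : ∀ {m} → m ∣ + M → m ∣ + 2 * (+ M) ^ 5
    M∣y {m} d = ∣n⇒∣m*n {m} (+ 2) {(+ M) ^ 5} (∣m⇒∣m*n {m} {+ M} ((+ M) ^ 4) d)
    beyond : (∃[ p ] Splitting p × (p ≢ 11 → ¬ + p ∣ + 2 * (+ M) ^ 5)) → ∃[ p ] N ℕ.< p × Splitting p
    beyond (p , g , p∤y) = p , ℕ.≰⇒> p≰N , g
      where
      open Splitting g
      p≰N : ¬ p ℕ.≤ N
      -- A prime p ≤ N other than 11 is one of the factors of M, hence divides y.
      p≰N p≤N = p∤y p≢11 (M∣y (∣ᵤ⇒∣ (∣factorial-without 11 (3 ℕ.+ N) (ℕ.≤-trans p≤N (ℕ.m≤n+m N 3))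
        (p≢11 ∘ sym ∘ prime-∣-prime prime-11 prime) (ℕ.>-nonZero⁻¹ p ⦃ prime⇒nonZero prime ⦄))))

  -- Valuations and congruences of rationals

  toℚᵘ-fromℤ : ∀ n → toℚᵘ (fromℤ n) ℚᵘ.≃ mkℚᵘ n 0
  toℚᵘ-fromℤ n = ℚ.toℚᵘ-fromℚᵘ (mkℚᵘ n 0)

  fromℤ-coprime : ∀ n → Coprime (abs n) 1
  fromℤ-coprime n = ℕ.sym (1-coprimeTo (abs n))

  -- `ν` inspects the numerator, which is explicit in this form but hidden behind the gcd reduction
  -- in n / 1.
  fromℤ≡mkℚ : ∀ n → fromℤ n ≡ mkℚ n 0 (fromℤ-coprime n)
  fromℤ≡mkℚ n = ℚ.↥p/↧p≡p (mkℚ n 0 (fromℤ-coprime n))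

  numerator-cross : ∀ x {k c} → toℚᵘ x ℚᵘ.≃ mkℚᵘ k c → ↥ x * + suc c ≡ k * ↧ x
  numerator-cross (mkℚ _ _ _) (*≡* eq) = eq

  module _ (s : ℤ) {y : ℚ} (y≃s/3 : toℚᵘ y ℚᵘ.≃ mkℚᵘ s 2) where

    -- For the multiplier m of the congruence, 3(a - b) = m(3n - s), and m is coprime to M.
    thirds-congruence : ∀ {M} n → fromℤ n ≡ y [mod M ] → + M ∣ + 3 * n - s
    thirds-congruence {M} n (m , coprime , a , b , mn≡a , my≡b , M∣a-b) =
      ∣ᵤ⇒∣ (ℤ.coprime-divisor (+ M) m (+ 3 * n - s) (ℤ.sym {m} {+ M} (ℕ.gcd≡1⇒coprime (+-injective coprime)))
        (∣⇒∣ᵤ (subst (+ M ∣_) scaled (∣n⇒∣m*n {+ M} (+ 3) (∣ᵤ⇒∣ M∣a-b)))))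
      where
      cross : ∀ {x k c} → toℚᵘ x ℚᵘ.≃ mkℚᵘ k c → ∀ e → fromℤ m ℚ.* x ≡ fromℤ e → m * k * + 1 ≡ e * (+ suc c)
      cross {x} {k} {c} x≃ e eq with ℚᵘ.≃-trans (ℚᵘ.≃-sym (ℚᵘ.*-cong (toℚᵘ-fromℤ m) x≃))
        (ℚᵘ.≃-trans (ℚᵘ.≃-sym (ℚ.toℚᵘ-homo-* (fromℤ m) x)) (ℚᵘ.≃-trans (ℚ.toℚᵘ-cong eq) (toℚᵘ-fromℤ e)))
      ... | *≡* eq′ = trans eq′ (cong (λ d → e * + suc d) (ℕ.+-identityʳ c))
      mn1≡a1 : m * n * + 1 ≡ a * + 1
      mn1≡a1 = cross (toℚᵘ-fromℤ n) a mn≡a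
      ms1≡b3 : m * s * + 1 ≡ b * + 3
      ms1≡b3 = cross y≃s/3 b my≡b
      scaled : + 3 * (a - b) ≡ m * (+ 3 * n - s)
      scaled = trans (split a b) (trans (cong₂ (λ i j → + 3 * i - j) (sym mn1≡a1) (sym ms1≡b3)) (join m n s))
        where
        split : ∀ a b → + 3 * (a - b) ≡ + 3 * (a * + 1) - b * + 3
        split = solve-∀
        join : ∀ m n s → + 3 * (m * n * + 1) - m * s * + 1 ≡ m * (+ 3 * n - s)
        join = solve-∀

    -- Cross-multiplied, because the fraction (3n - s)/3 is not assumed to be in lowest terms.
    thirds-numerator : ∀ n → (let x = fromℤ n ℚ.- y) → ↥ x * + 3 ≡ (+ 3 * n - s) * ↧ x
    thirds-numerator n = trans (numerator-cross x (ℚᵘ.≃-trans (ℚ.toℚᵘ-homo-+ (fromℤ n) (ℚ.- y))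
      (ℚᵘ.+-cong (toℚᵘ-fromℤ n) (ℚᵘ.≃-trans (ℚ.toℚᵘ-homo‿- y) (ℚᵘ.-‿cong y≃s/3)))))
      (cong (_* ↧ x) (rearrange n s))
      where
      x : ℚ
      x = fromℤ n ℚ.- y
      rearrange : ∀ n s → n * + 3 + - s * + 1 ≡ + 3 * n - s
      rearrange = solve-∀

  module _ {p : ℕ} (pr : Prime p) where

    private
      1<p : 1 ℕ.< p
      1<p = ℕ.nonTrivial⇒n>1 p ⦃ prime⇒nonTrivial pr ⦄

    νℕ-1 : νℕ p 1 ≡ 0
    νℕ-1 with ℕ.m^n≡1⇒n≡0∨m≡1 p (νℕ p 1) (ℕ.∣1⇒≡1 (νℕ-divides p 1))
    ... | inj₁ ν≡0 = ν≡0
    ... | inj₂ p≡1 = contradiction p≡1 (ℕ.nonTrivial⇒≢1 ⦃ prime⇒nonTrivial pr ⦄)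

    -- The denominator of `fromℤ t` has valuation 0 and that of x can only lower the right-hand
    -- side, so comparing numerators suffices; t = 0 gives `⊤⁺`.
    ν-≥⁺ : ∀ t x → ↥ x ≢ + 0 → (t ≢ + 0 → νℕ p (abs (↥ x)) ℕ.≤ νℕ p (abs t)) →
           ν p (fromℤ t) ≥⁺ ν p x
    ν-≥⁺ t x x≢0 ν≤ = subst (λ y → ν p y ≥⁺ ν p x) (sym (fromℤ≡mkℚ t)) (compare t x x≢0 ν≤)
      where
      shifted : ∀ {i j} k → i ℕ.≤ j → + i - + k ℤ.≤ + j - + νℕ p 1
      shifted {i} {j} k i≤j = subst (λ e → + i - + k ℤ.≤ + j - + e) (sym νℕ-1)
        (subst (+ i - + k ℤ.≤_) (sym (+-identityʳ (+ j))) (i≤j⇒i-k≤j (+ k) (ℤ.+≤+ i≤j)))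
      compare : ∀ t x → ↥ x ≢ + 0 → (t ≢ + 0 → νℕ p (abs (↥ x)) ℕ.≤ νℕ p (abs t)) →
                ν p (mkℚ t 0 (fromℤ-coprime t)) ≥⁺ ν p x
      compare (+ zero)    x                      x≢0 ν≤ = ν p x Sup.≤⊤⁺
      compare t           (mkℚ (+ zero) d c)     x≢0 ν≤ = contradiction refl x≢0
      compare (+ (suc t)) (mkℚ (+ (suc a)) d c)  x≢0 ν≤ = Sup.[ shifted (νℕ p (suc d)) (ν≤ λ ()) ]
      compare (+ (suc t)) (mkℚ -[1+ a ] d c)     x≢0 ν≤ = Sup.[ shifted (νℕ p (suc d)) (ν≤ λ ()) ]
      compare -[1+ t ]    (mkℚ (+ (suc a)) d c)  x≢0 ν≤ = Sup.[ shifted (νℕ p (suc d)) (ν≤ λ ()) ]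
      compare -[1+ t ]    (mkℚ -[1+ a ] d c)     x≢0 ν≤ = Sup.[ shifted (νℕ p (suc d)) (ν≤ λ ()) ]

    -- The power pᵉ exactly dividing the numerator of x is coprime to the denominator, so it divides
    -- z and hence t.
    ν-≥⁺-of-divisibility : ∀ {c} t z x → ↥ x * + suc c ≡ z * ↧ x → z ≢ + 0 →
      (∀ k → + (p ℕ.^ k) ∣ z → + (p ℕ.^ k) ∣ t) → ν p (fromℤ t) ≥⁺ ν p x
    ν-≥⁺-of-divisibility {c} t z x@(mkℚ a d-1 coprime) eq z≢0 divisibility = ν-≥⁺ t x a≢0
      λ t≢0 → νℕ-greatest p (abs t) 1<p (t≢0 ∘ ∣i∣≡0⇒i≡0)
        (∣⇒∣ᵤ (divisibility e (∣ᵤ⇒∣ (coprime-divisor e-coprime (subst (p ℕ.^ e ℕ.∣_) abs-eq (ℕ.∣m⇒∣m*n (suc c) p^e∣a))))))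
      where
      e : ℕ
      e = νℕ p (abs a)
      p^e∣a : p ℕ.^ e ℕ.∣ abs a
      p^e∣a = νℕ-divides p (abs a)
      e-coprime : Coprime (p ℕ.^ e) (suc d-1)
      e-coprime (i∣p^e , i∣d) = ℕ.recompute coprime (ℕ.∣-trans i∣p^e p^e∣a , i∣d)
      abs-eq : abs a ℕ.* suc c ≡ suc d-1 ℕ.* abs z
      abs-eq = trans (sym (abs-* a (+ suc c))) (trans (cong abs eq) (trans (abs-* z (+ suc d-1)) (ℕ.*-comm (abs z) (suc d-1))))
      a≢0 : a ≢ + 0
      a≢0 refl = case i*j≡0⇒i≡0∨j≡0 z (sym eq) of λ { (inj₁ z≡0) → z≢0 z≡0 ; (inj₂ ()) }

  -- Used for k = 0 and k = -2, that is for 1 and -5: the valuations of n - 1/3 and n + 5/3 are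
  -- finite.
  3n≢1+3k : ∀ k n → + 3 * n - (+ 1 + + 3 * k) ≢ + 0
  3n≢1+3k k n eq = toWitnessFalse {a? = 3 ℕ.∣? 1} _ (∣⇒∣ᵤ {+ 3} {+ 1} (divides (n - k)
    (trans (isolate n k) (trans (cong (λ i → (n - k) * + 3 - i) eq) (+-identityʳ ((n - k) * + 3))))))
    where
    isolate : ∀ n k → + 1 ≡ (n - k) * + 3 - (+ 3 * n - (+ 1 + + 3 * k))
    isolate = solve-∀

  -- From the two divisibility conditions on 3n - 1 to the valuation bounds

  p-1∣p^k-1 : ∀ p-1 k → + p-1 ∣ + (suc p-1 ℕ.^ k) - + 1
  p-1∣p^k-1 p-1 zero    = divides (+ 0) refl
  p-1∣p^k-1 p-1 (suc k) = ∣-combine (+ (suc p-1 ℕ.^ k)) (+ 1) (∣-refl {+ p-1}) (p-1∣p^k-1 p-1 k)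
    (trans (cong (_- + 1) (pos-* (suc p-1) (suc p-1 ℕ.^ k))) (identity (+ p-1) (+ (suc p-1 ℕ.^ k))))
    where
    identity : ∀ m q → (+ 1 + m) * q - + 1 ≡ q * m + + 1 * (q - + 1)
    identity = solve-∀

  -- If 3n - 1 = c pᵏ, then pᵏ ≡ 1 modulo p - 1 yields p - 1 ∣ c, so 3n - 1 is a multiple of pᵏ(p -
  -- 1). The divisor pᵏ⁺¹ so obtained is weakened to pᵏ.
  T-zeros-∣ : ∀ {q} → Splitting (2 ℕ.+ q ℕ.* 3) → (let p = 2 ℕ.+ q ℕ.* 3) →
    ∀ n → + (p ℕ.∸ 1) ∣ + 3 * n - + 1 → ∀ k → + (p ℕ.^ k) ∣ + 3 * n - + 1 →
    (+ (p ℕ.^ k) ∣ T n) × (+ (p ℕ.^ k) ∣ T (n - + 2))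
  T-zeros-∣ {q} split n p-1∣ k (divides c eq) = ∣-trans p^k∣p^[1+k] (proj₁ zeros) , ∣-trans p^k∣p^[1+k] (proj₂ zeros)
    where
    open Splitting split
    p-1 p : ℕ
    p-1 = suc (q ℕ.* 3)
    p = suc p-1
    p^k∣p^[1+k] : + (p ℕ.^ k) ∣ + (p ℕ.^ suc k)
    p^k∣p^[1+k] = divides (+ p) (pos-* p (p ℕ.^ k))
    ∤-prime : ∀ r → Prime r → p ≢ r → ¬ + p ∣ + r
    ∤-prime r pr p≢r d = p≢r (prime-∣-prime prime pr (∣⇒∣ᵤ d))
    p-1∣c : + p-1 ∣ c
    p-1∣c = ∣-combine (+ 1) (- c) p-1∣ (p-1∣p^k-1 p-1 k)
      (trans (isolate c (+ (p ℕ.^ k))) (cong (λ i → + 1 * i + - c * (+ (p ℕ.^ k) - + 1)) (sym eq)))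
      where
      isolate : ∀ c q → c ≡ + 1 * (c * q) + - c * (q - + 1)
      isolate = solve-∀
    zeros : (+ (p ℕ.^ suc k) ∣ T n) × (+ (p ℕ.^ suc k) ∣ T (n - + 2))
    zeros = quotients p-1∣c
      where
      quotients : + p-1 ∣ c → (+ (p ℕ.^ suc k) ∣ T n) × (+ (p ℕ.^ suc k) ∣ T (n - + 2))
      -- 2 and 11 are excluded by fields of `Splitting`, 3 and 19 by their residues 0 and 1 modulo
      -- 3.
      quotients (divides t c≡) = T-zeros {q} prime
        (∤-prime 2 (toWitness {a? = prime? 2} _) p≢2)
        (∤-prime 3 (toWitness {a? = prime? 3} _)
          (λ p≡3 → contradiction (trans (sym (cong (_% 3) p≡3)) p%3≡2) λ ()))
        (∤-prime 11 prime-11 p≢11)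
        (∤-prime 19 (toWitness {a? = prime? 19} _)
          (λ p≡19 → contradiction (trans (sym (cong (_% 3) p≡19)) p%3≡2) λ ()))
        d p∣h k n t
        (trans eq (trans (cong (_* + (p ℕ.^ k)) c≡) (swap t (+ p-1) (+ (p ℕ.^ k)))))
        where
        swap : ∀ t m q → t * m * q ≡ t * (q * m)
        swap = solve-∀

  module _ {p : ℕ} (split : Splitting p) where

    open Splitting split

    -- Division by 3 brings p into the form 2 + 3q on which the preceding arguments compute.
    T-zeros-mod : ∀ n → + (p ℕ.∸ 1) ∣ + 3 * n - + 1 → ∀ k → + (p ℕ.^ k) ∣ + 3 * n - + 1 →
      (+ (p ℕ.^ k) ∣ T n) × (+ (p ℕ.^ k) ∣ T (n - + 2))
    T-zeros-mod = recast p {p ℕ./ 3} (trans (m≡m%n+[m/n]*n p 3) (cong (ℕ._+ (p ℕ./ 3) ℕ.* 3) p%3≡2)) split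
      where
      recast : ∀ p {q} → p ≡ 2 ℕ.+ q ℕ.* 3 → Splitting p →
        ∀ n → + (p ℕ.∸ 1) ∣ + 3 * n - + 1 → ∀ k → + (p ℕ.^ k) ∣ + 3 * n - + 1 →
        (+ (p ℕ.^ k) ∣ T n) × (+ (p ℕ.^ k) ∣ T (n - + 2))
      recast _ {q} refl split = T-zeros-∣ {q} split

    zero-1/3 : ∀ n → fromℤ n ≡ + 1 ℚ./ 3 [mod p ℕ.∸ 1 ] → ν p (fromℤ (T n)) ≥⁺ ν p (fromℤ n ℚ.- + 1 ℚ./ 3)
    zero-1/3 n n≡1/3 = ν-≥⁺-of-divisibility prime {2} (T n) (+ 3 * n - + 1) (fromℤ n ℚ.- + 1 ℚ./ 3)
      (thirds-numerator (+ 1) {+ 1 ℚ./ 3} (*≡* refl) n) (3n≢1+3k (+ 0) n)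
      (λ k → proj₁ ∘ T-zeros-mod n (thirds-congruence (+ 1) {+ 1 ℚ./ 3} (*≡* refl) n n≡1/3) k)

    -- Since -5/3 + 2 = 1/3, this is the statement about T(n′ - 2) at n′ = n + 2.
    zero-−5/3 : ∀ n → fromℤ n ≡ ℚ.- (+ 5 ℚ./ 3) [mod p ℕ.∸ 1 ] → ν p (fromℤ (T n)) ≥⁺ ν p (fromℤ n ℚ.+ + 5 ℚ./ 3)
    zero-−5/3 n n≡-5/3 = ν-≥⁺-of-divisibility prime {2} (T n) (+ 3 * n - - (+ 5)) (fromℤ n ℚ.+ + 5 ℚ./ 3)
      (thirds-numerator (- (+ 5)) {ℚ.- (+ 5 ℚ./ 3)} (*≡* refl) n) (3n≢1+3k (- (+ 2)) n)
      (λ k p^k∣ → subst (λ i → + (p ℕ.^ k) ∣ T i) (unshift n) (proj₂ (T-zeros-mod (n + + 2)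
        (subst (+ (p ℕ.∸ 1) ∣_) (shift n) (thirds-congruence (- (+ 5)) {ℚ.- (+ 5 ℚ./ 3)} (*≡* refl) n n≡-5/3)) k
        (subst (+ (p ℕ.^ k) ∣_) (shift n) p^k∣))))
      where
      shift : ∀ n → + 3 * n - - (+ 5) ≡ + 3 * (n + + 2) - + 1
      shift = solve-∀
      unshift : ∀ n → n + + 2 - + 2 ≡ n
      unshift = solve-∀

open import Data.Rational using (_/_; _+_; _-_; -_)

theorem4 : Σ[ S ∈ Pred ℕ 0ℓ ] Infinite S
    × (∀ p → p ∈ S → Prime p × p % 3 ≡ 2)
    × (∀ p → p ∈ S →
    (∀ (n : ℤ) → fromℤ n ≡ + 1 / 3 [mod p ∸ 1 ] →
    ν p (fromℤ (T n)) ≥⁺ ν p (fromℤ n - + 1 / 3))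
    × (∀ (n : ℤ) → fromℤ n ≡ - (+ 5 / 3) [mod p ∸ 1 ] →
    ν p (fromℤ (T n)) ≥⁺ ν p (fromℤ n + + 5 / 3)))
theorem4 = Splitting , infinitely-many-splitting
  , (λ p split → Splitting.prime split , Splitting.p%3≡2 split)
  , (λ p split → zero-1/3 split , zero-−5/3 split)
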